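{- For every fixed real number $0<c<1/4$ there exists $n_0$ such that for all integers $n\ge n_0$, \[ |\mathcal T_n|\ge \exp(c\,n\log n), \] where $\mathcal T_n=\{\tau(G): G \text{ is a simple graph on } n \text{ vertices}\}$ and $\tau(G)$ denotes the number of spanning trees of $G$.
   Context: For a finite graph $G$, $\tau(G)$ denotes the number of spanning trees of $G$. $\log$ is the natural logarithm. -}

module Defs where

open import Data.Nat using (ℕ; _≤_)
open import Data.Bool using (Bool; true; false)
open import Data.Fin using (Fin)
open import Data.Vec using (Vec; lookup)
open import Data.List using (List; []; _∷_; _++_; length)
open import Data.List.Relation.Unary.Unique.Propositional using (Unique)
open import Data.List.Relation.Unary.Linked using (Linked)
open import Data.List.Membership.Propositional using (_∈_)
open import Data.Product using (Σ; _×_)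
open import Relation.Binary.PropositionalEquality using (_≡_)
open import Relation.Nullary using (¬_)
open import Function.Bundles using (_⇔_)

Adj : ℕ → Set
Adj n = Vec (Vec Bool n) n

adj : ∀ {n} → Adj n → Fin n → Fin n → Bool
adj A i j = lookup (lookup A i) j

Edge : ∀ {n} → Adj n → Fin n → Fin n → Set
Edge A i j = adj A i j ≡ true

-- A simple graph on vertex set Fin n: symmetric adjacency, no loops.
-- (Simple graphs on n labelled vertices correspond bijectively to such matrices.)
IsSimple : ∀ {n} → Adj n → Set
IsSimple {n} A = ((i j : Fin n) → adj A i j ≡ adj A j i) × ((i : Fin n) → adj A i i ≡ false)

Subgraph : ∀ {n} → Adj n → Adj n → Set
Subgraph {n} T G = (i j : Fin n) → Edge T i j → Edge G i j

data Reach {n} (A : Adj n) : Fin n → Fin n → Set where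
  here : ∀ {u} → Reach A u u
  step : ∀ {u w v} → Edge A u w → Reach A w v → Reach A u v

Connected : ∀ {n} → Adj n → Set
Connected {n} A = (u v : Fin n) → Reach A u v

HasCycle : ∀ {n} → Adj n → Set
HasCycle {n} A =
  Σ (Fin n) λ x → Σ (List (Fin n)) λ xs →
    (2 ≤ length xs) × Unique (x ∷ xs) × Linked (Edge A) (x ∷ xs ++ x ∷ [])

IsTree : ∀ {n} → Adj n → Set
IsTree A = Connected A × ¬ HasCycle A

IsSpanningTree : ∀ {n} → Adj n → Adj n → Set
IsSpanningTree G T = IsSimple T × Subgraph T G × IsTree T

HasSize : ∀ {A : Set} → (A → Set) → ℕ → Set
HasSize {A} P k = Σ (List A) λ xs → Unique xs × ((x : A) → P x ⇔ (x ∈ xs)) × (length xs ≡ k)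

SpanningTreeCount : ∀ {n} → Adj n → ℕ → Set
SpanningTreeCount G k = HasSize (IsSpanningTree G) k

InT : ℕ → ℕ → Set
InT n m = Σ (Adj n) λ G → IsSimple G × SpanningTreeCount G m

{-# OPTIONS --safe #-}
module Submission where

-- Take a path of m vertices, a second copy of it, a set of hub vertices and a universal root, and join the
-- i-th vertex of both copies to the first wᵢ hub vertices. On vectors that are antisymmetric under exchanging
-- the copies and vanish elsewhere the Laplacian is tridiagonal with off-diagonal entries -1 and prescribed
-- diagonal d₁, …, dₘ, so by the matrix-tree theorem the continuant K(d₁, …, dₘ) divides τ(G). With m about n/2
-- and n/C hub vertices there are n^{n/2 - o(n)} diagonals. The pair of K(d₁, …, dₘ) and
-- K(d₂, …, dₘ) determines the diagonal, so one of the two takes at least n^{n/4 - o(n)} values; and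
-- since a number below n^n has only n^{o(n)} divisors, so does τ.
--
-- Determinants are computed in the exterior algebra of ℤⁿ: the wedge of the rows e_v - e_{f v} is the volume
-- form if the parent map f is acyclic, and 0 otherwise.

-- Extra edges at a path vertex normally bring in the rows and columns of their other ends. Doubling
-- the path removes these: on antisymmetric vectors the hub edges of the two copies cancel, and only
-- their number survives, on the diagonal. The price is that each free diagonal entry costs two
-- vertices; the square root lost to pairs of continuants then turns 1/2 into 1/4. The cofactor of
-- the continuant in τ(G) varies with the diagonal and is never evaluated. Different continuants may
-- therefore lead to the same τ(G), and divisibility is all that separates them. Bounding the
-- collisions by a divisor count requires τ(G) > 0, which the universal root guarantees, and a crude
-- upper bound for τ(G). Real numbers do not occur. The constant c becomes a fraction p/q with 4p <
-- q, and estimates that would need roots or logarithms are stated for integer powers and combined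
-- at the end. The losses, from the hub vertices and from the divisor count, are fractions of order
-- 1/q of the exponent, chosen to fit into the gap between p/q and 1/4.

-- Exterior algebra: wedge products of rows and their top coefficient

module ExteriorAlgebra where

  open import Data.Nat using (ℕ; zero; suc)
  open import Data.Integer using (ℤ; 0ℤ; 1ℤ; -1ℤ; _+_; _*_; -_; _-_)
  import Data.Integer.Properties as ℤ
  open import Data.Integer.Tactic.RingSolver using (solve-∀)
  open import Data.Fin using (Fin; zero; suc)
  open import Data.List using (List; []; _∷_; _++_; foldr; map; length)
  open import Data.List.Membership.Propositional using (_∈_)
  open import Data.List.Relation.Unary.Any using (here; there)
  open import Data.List.Relation.Unary.All using (All; []; _∷_)
  open import Data.List.Relation.Binary.Permutation.Propositional using (_↭_; refl; prep; swap; trans)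
  open import Data.Product using (_×_; _,_; ∃)
  open import Data.Unit using (⊤; tt)
  open import Function using (_∘_)
  open import Relation.Binary.PropositionalEquality
    using (_≡_; refl; sym; cong; cong₂; subst; module ≡-Reasoning)
  import Relation.Binary.PropositionalEquality as ≡

  Vect : ℕ → Set
  Vect n = Fin n → ℤ

  -- The exterior algebra of ℤⁿ: (x , y) stands for x + e₀ ∧ y, with x and y free of e₀.
  Λ : ℕ → Set
  Λ zero = ℤ
  Λ (suc n) = Λ n × Λ n

  infixl 6 _⊕_ _⊖_
  infixr 7 _⊙_
  infixr 7 _∧_

  _⊕_ : ∀ {n} → Λ n → Λ n → Λ n
  _⊕_ {zero} x y = x + y
  _⊕_ {suc n} (x , y) (x′ , y′) = x ⊕ x′ , y ⊕ y′

  _⊙_ : ∀ {n} → ℤ → Λ n → Λ n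
  _⊙_ {zero} k x = k * x
  _⊙_ {suc n} k (x , y) = k ⊙ x , k ⊙ y

  0Λ : ∀ {n} → Λ n
  0Λ {zero} = 0ℤ
  0Λ {suc n} = 0Λ , 0Λ

  1Λ : ∀ {n} → Λ n
  1Λ {zero} = 1ℤ
  1Λ {suc n} = 1Λ , 0Λ

  _⊖_ : ∀ {n} → Λ n → Λ n → Λ n
  x ⊖ y = x ⊕ -1ℤ ⊙ y

  -- For v = v₀ e₀ + w the product with x + e₀ ∧ y is w ∧ x + e₀ ∧ (v₀ x - w ∧ y); the sign comes
  -- from moving w past e₀.
  _∧_ : ∀ {n} → Vect n → Λ n → Λ n
  _∧_ {zero} v x = 0ℤ
  _∧_ {suc n} v (x , y) = (v ∘ suc) ∧ x , v zero ⊙ x ⊖ (v ∘ suc) ∧ y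

  ⊕-comm : ∀ {n} (x y : Λ n) → x ⊕ y ≡ y ⊕ x
  ⊕-comm {zero} = ℤ.+-comm
  ⊕-comm {suc n} (x , y) (x′ , y′) = cong₂ _,_ (⊕-comm x x′) (⊕-comm y y′)

  ⊕-assoc : ∀ {n} (x y z : Λ n) → (x ⊕ y) ⊕ z ≡ x ⊕ (y ⊕ z)
  ⊕-assoc {zero} = ℤ.+-assoc
  ⊕-assoc {suc n} (x , y) (x′ , y′) (x″ , y″) = cong₂ _,_ (⊕-assoc x x′ x″) (⊕-assoc y y′ y″)

  ⊕-identityˡ : ∀ {n} (x : Λ n) → 0Λ ⊕ x ≡ x
  ⊕-identityˡ {zero} = ℤ.+-identityˡ
  ⊕-identityˡ {suc n} (x , y) = cong₂ _,_ (⊕-identityˡ x) (⊕-identityˡ y)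

  ⊕-identityʳ : ∀ {n} (x : Λ n) → x ⊕ 0Λ ≡ x
  ⊕-identityʳ x = ≡.trans (⊕-comm x 0Λ) (⊕-identityˡ x)

  ⊙-zeroˡ : ∀ {n} (x : Λ n) → 0ℤ ⊙ x ≡ 0Λ
  ⊙-zeroˡ {zero} x = ℤ.*-zeroˡ x
  ⊙-zeroˡ {suc n} (x , y) = cong₂ _,_ (⊙-zeroˡ x) (⊙-zeroˡ y)

  ⊙-zeroʳ : ∀ {n} k → k ⊙ 0Λ {n} ≡ 0Λ
  ⊙-zeroʳ {zero} k = ℤ.*-zeroʳ k
  ⊙-zeroʳ {suc n} k = cong₂ _,_ (⊙-zeroʳ k) (⊙-zeroʳ k)

  ⊙-identity : ∀ {n} (x : Λ n) → 1ℤ ⊙ x ≡ x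
  ⊙-identity {zero} = ℤ.*-identityˡ
  ⊙-identity {suc n} (x , y) = cong₂ _,_ (⊙-identity x) (⊙-identity y)

  ⊙-assoc : ∀ {n} j k (x : Λ n) → (j * k) ⊙ x ≡ j ⊙ k ⊙ x
  ⊙-assoc {zero} = ℤ.*-assoc
  ⊙-assoc {suc n} j k (x , y) = cong₂ _,_ (⊙-assoc j k x) (⊙-assoc j k y)

  ⊙-distribʳ : ∀ {n} j k (x : Λ n) → (j + k) ⊙ x ≡ j ⊙ x ⊕ k ⊙ x
  ⊙-distribʳ {zero} j k x = ℤ.*-distribʳ-+ x j k
  ⊙-distribʳ {suc n} j k (x , y) = cong₂ _,_ (⊙-distribʳ j k x) (⊙-distribʳ j k y)

  ⊖-self : ∀ {n} (x : Λ n) → x ⊖ x ≡ 0Λ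
  ⊖-self {zero} = solved
    where
    solved : ∀ x → x + -1ℤ * x ≡ 0ℤ
    solved = solve-∀
  ⊖-self {suc n} (x , y) = cong₂ _,_ (⊖-self x) (⊖-self y)

  private
    additivityʳ : ∀ {n} c (a b p q : Λ n) →
      c ⊙ (a ⊕ b) ⊖ (p ⊕ q) ≡ (c ⊙ a ⊖ p) ⊕ (c ⊙ b ⊖ q)
    additivityʳ {zero} = solved
      where
      solved : ∀ c a b p q → c * (a + b) + -1ℤ * (p + q) ≡ c * a + -1ℤ * p + (c * b + -1ℤ * q)
      solved = solve-∀
    additivityʳ {suc n} c (a , a′) (b , b′) (p , p′) (q , q′) =
      cong₂ _,_ (additivityʳ c a b p q) (additivityʳ c a′ b′ p′ q′)

    additivityˡ : ∀ {n} c d (a p q : Λ n) →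
      (c + d) ⊙ a ⊖ (p ⊕ q) ≡ (c ⊙ a ⊖ p) ⊕ (d ⊙ a ⊖ q)
    additivityˡ {zero} = solved
      where
      solved : ∀ c d a p q → (c + d) * a + -1ℤ * (p + q) ≡ c * a + -1ℤ * p + (d * a + -1ℤ * q)
      solved = solve-∀
    additivityˡ {suc n} c d (a , a′) (p , p′) (q , q′) =
      cong₂ _,_ (additivityˡ c d a p q) (additivityˡ c d a′ p′ q′)

    homogeneityʳ : ∀ {n} c k (a p : Λ n) → c ⊙ k ⊙ a ⊖ k ⊙ p ≡ k ⊙ (c ⊙ a ⊖ p)
    homogeneityʳ {zero} = solved
      where
      solved : ∀ c k a p → c * (k * a) + -1ℤ * (k * p) ≡ k * (c * a + -1ℤ * p)
      solved = solve-∀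
    homogeneityʳ {suc n} c k (a , a′) (p , p′) =
      cong₂ _,_ (homogeneityʳ c k a p) (homogeneityʳ c k a′ p′)

    homogeneityˡ : ∀ {n} c k (a p : Λ n) → (k * c) ⊙ a ⊖ k ⊙ p ≡ k ⊙ (c ⊙ a ⊖ p)
    homogeneityˡ c k a p =
      ≡.trans (cong (_⊖ k ⊙ p) (≡.trans (cong (_⊙ a) (ℤ.*-comm k c)) (⊙-assoc c k a)))
              (homogeneityʳ c k a p)

    cancellation : ∀ {n} c (a p : Λ n) → c ⊙ a ⊖ (c ⊙ a ⊖ p) ≡ p
    cancellation {zero} = solved
      where
      solved : ∀ c a p → c * a + -1ℤ * (c * a + -1ℤ * p) ≡ p
      solved = solve-∀
    cancellation {suc n} c (a , a′) (p , p′) =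
      cong₂ _,_ (cancellation c a p) (cancellation c a′ p′)

    negation : ∀ {n} (x y : Λ n) → x ≡ -1ℤ ⊙ y ⊕ (x ⊕ y)
    negation {zero} = solved
      where
      solved : ∀ x y → x ≡ -1ℤ * y + (x + y)
      solved = solve-∀
    negation {suc n} (x , x′) (y , y′) = cong₂ _,_ (negation x y) (negation x′ y′)

    -- The two components of the Leibniz rule for the interior product.
    leibniz₀ : ∀ {n} c g d (x y p : Λ n) →
      (d ⊙ x ⊖ p) ⊕ g ⊙ (c ⊙ x ⊖ y) ≡ (c * g + d) ⊙ x ⊖ (p ⊕ g ⊙ y)
    leibniz₀ {zero} = solved
      where
      solved : ∀ c g d x y p →
        d * x + -1ℤ * p + g * (c * x + -1ℤ * y) ≡ (c * g + d) * x + -1ℤ * (p + g * y)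
      solved = solve-∀
    leibniz₀ {suc n} c g d (x , x′) (y , y′) (p , p′) =
      cong₂ _,_ (leibniz₀ c g d x y p) (leibniz₀ c g d x′ y′ p′)

    leibniz₁ : ∀ {n} c g d (y s q : Λ n) →
      -1ℤ ⊙ (c ⊙ s ⊖ (d ⊙ y ⊖ q)) ≡ (c * g + d) ⊙ y ⊖ (c ⊙ (s ⊕ g ⊙ y) ⊖ -1ℤ ⊙ q)
    leibniz₁ {zero} = solved
      where
      solved : ∀ c g d y s q → -1ℤ * (c * s + -1ℤ * (d * y + -1ℤ * q)) ≡
        (c * g + d) * y + -1ℤ * (c * (s + g * y) + -1ℤ * (-1ℤ * q))
      solved = solve-∀
    leibniz₁ {suc n} c g d (y , y′) (s , s′) (q , q′) =
      cong₂ _,_ (leibniz₁ c g d y s q) (leibniz₁ c g d y′ s′ q′)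

  ∧-cong : ∀ {n} {u v : Vect n} → (∀ i → u i ≡ v i) → (x : Λ n) → u ∧ x ≡ v ∧ x
  ∧-cong {zero} u≗v x = refl
  ∧-cong {suc n} u≗v (x , y) = cong₂ _,_ (∧-cong (u≗v ∘ suc) x)
    (cong₂ _⊖_ (cong (_⊙ x) (u≗v zero)) (∧-cong (u≗v ∘ suc) y))

  ∧-distribˡ : ∀ {n} (v : Vect n) x y → v ∧ (x ⊕ y) ≡ v ∧ x ⊕ v ∧ y
  ∧-distribˡ {zero} v x y = refl
  ∧-distribˡ {suc n} v (x , y) (x′ , y′) = cong₂ _,_ (∧-distribˡ (v ∘ suc) x x′)
    (≡.trans (cong ((v zero ⊙ (x ⊕ x′)) ⊖_) (∧-distribˡ (v ∘ suc) y y′))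
             (additivityʳ (v zero) x x′ _ _))

  ∧-distribʳ : ∀ {n} (u v : Vect n) x → (λ i → u i + v i) ∧ x ≡ u ∧ x ⊕ v ∧ x
  ∧-distribʳ {zero} u v x = refl
  ∧-distribʳ {suc n} u v (x , y) = cong₂ _,_ (∧-distribʳ (u ∘ suc) (v ∘ suc) x)
    (≡.trans (cong (((u zero + v zero) ⊙ x) ⊖_) (∧-distribʳ (u ∘ suc) (v ∘ suc) y))
             (additivityˡ (u zero) (v zero) x _ _))

  ∧-⊙ : ∀ {n} (v : Vect n) k x → v ∧ k ⊙ x ≡ k ⊙ v ∧ x
  ∧-⊙ {zero} v k x = sym (ℤ.*-zeroʳ k)
  ∧-⊙ {suc n} v k (x , y) = cong₂ _,_ (∧-⊙ (v ∘ suc) k x)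
    (≡.trans (cong ((v zero ⊙ k ⊙ x) ⊖_) (∧-⊙ (v ∘ suc) k y)) (homogeneityʳ (v zero) k x _))

  *-∧ : ∀ {n} k (v : Vect n) x → (λ i → k * v i) ∧ x ≡ k ⊙ v ∧ x
  *-∧ {zero} k v x = sym (ℤ.*-zeroʳ k)
  *-∧ {suc n} k v (x , y) = cong₂ _,_ (*-∧ k (v ∘ suc) x)
    (≡.trans (cong (((k * v zero) ⊙ x) ⊖_) (*-∧ k (v ∘ suc) y)) (homogeneityˡ (v zero) k x _))

  ∧-zeroʳ : ∀ {n} (v : Vect n) → v ∧ 0Λ ≡ 0Λ
  ∧-zeroʳ v = begin
    v ∧ 0Λ        ≡⟨ cong (v ∧_) (⊙-zeroˡ 0Λ) ⟨
    v ∧ 0ℤ ⊙ 0Λ   ≡⟨ ∧-⊙ v 0ℤ 0Λ ⟩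
    0ℤ ⊙ v ∧ 0Λ   ≡⟨ ⊙-zeroˡ _ ⟩
    0Λ            ∎
    where open ≡-Reasoning

  ∧-zeroˡ : ∀ {n} (v : Vect n) → (∀ i → v i ≡ 0ℤ) → ∀ x → v ∧ x ≡ 0Λ
  ∧-zeroˡ v v≗0 x = begin
    v ∧ x                  ≡⟨ ∧-cong (λ i → ≡.trans (v≗0 i) (sym (ℤ.*-zeroˡ (v i)))) x ⟩
    (λ i → 0ℤ * v i) ∧ x   ≡⟨ *-∧ 0ℤ v x ⟩
    0ℤ ⊙ v ∧ x             ≡⟨ ⊙-zeroˡ _ ⟩
    0Λ                     ∎
    where open ≡-Reasoning

  ∧-alternating : ∀ {n} (v : Vect n) x → v ∧ v ∧ x ≡ 0Λ
  ∧-alternating {zero} v x = refl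
  ∧-alternating {suc n} v (x , y) = cong₂ _,_ (∧-alternating w x) (begin
    c ⊙ w ∧ x ⊖ w ∧ (c ⊙ x ⊖ w ∧ y)
      ≡⟨ cong (c ⊙ w ∧ x ⊖_) (∧-distribˡ w (c ⊙ x) (-1ℤ ⊙ w ∧ y)) ⟩
    c ⊙ w ∧ x ⊖ (w ∧ c ⊙ x ⊕ w ∧ -1ℤ ⊙ w ∧ y)
      ≡⟨ cong (c ⊙ w ∧ x ⊖_) (cong₂ _⊕_ (∧-⊙ w c x) (∧-⊙ w -1ℤ (w ∧ y))) ⟩
    c ⊙ w ∧ x ⊖ (c ⊙ w ∧ x ⊕ -1ℤ ⊙ w ∧ w ∧ y)
      ≡⟨ cancellation c (w ∧ x) (w ∧ w ∧ y) ⟩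
    w ∧ w ∧ y
      ≡⟨ ∧-alternating w y ⟩
    0Λ ∎)
    where
    open ≡-Reasoning
    c = v zero
    w = v ∘ suc

  -- Polarisation: the square of u + v vanishes, and so do the squares of u and v, which leaves the
  -- two mixed terms with sum 0.
  ∧-anticomm : ∀ {n} (u v : Vect n) x → u ∧ v ∧ x ≡ -1ℤ ⊙ v ∧ u ∧ x
  ∧-anticomm u v x = begin
    u ∧ v ∧ x                                    ≡⟨ negation _ (v ∧ u ∧ x) ⟩
    -1ℤ ⊙ v ∧ u ∧ x ⊕ (u ∧ v ∧ x ⊕ v ∧ u ∧ x)    ≡⟨ cong (-1ℤ ⊙ v ∧ u ∧ x ⊕_) polarised ⟩
    -1ℤ ⊙ v ∧ u ∧ x ⊕ 0Λ                         ≡⟨ ⊕-identityʳ _ ⟩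
    -1ℤ ⊙ v ∧ u ∧ x                              ∎
    where
    open ≡-Reasoning
    s : Vect _
    s i = u i + v i
    half : ∀ w → w ∧ w ∧ x ≡ 0Λ → ∀ w′ → w ∧ w′ ∧ x ≡ w ∧ (w ∧ x ⊕ w′ ∧ x)
    half w ww w′ = begin
      w ∧ w′ ∧ x                   ≡⟨ ⊕-identityˡ _ ⟨
      0Λ ⊕ w ∧ w′ ∧ x              ≡⟨ cong (_⊕ w ∧ w′ ∧ x) ww ⟨
      w ∧ w ∧ x ⊕ w ∧ w′ ∧ x       ≡⟨ ∧-distribˡ w _ _ ⟨
      w ∧ (w ∧ x ⊕ w′ ∧ x)         ∎
    polarised : u ∧ v ∧ x ⊕ v ∧ u ∧ x ≡ 0Λ
    polarised = begin
      u ∧ v ∧ x ⊕ v ∧ u ∧ x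
        ≡⟨ cong₂ _⊕_ (half u (∧-alternating u x) v)
                     (≡.trans (half v (∧-alternating v x) u) (cong (v ∧_) (⊕-comm _ _))) ⟩
      u ∧ (u ∧ x ⊕ v ∧ x) ⊕ v ∧ (u ∧ x ⊕ v ∧ x)
        ≡⟨ ∧-distribʳ u v _ ⟨
      s ∧ (u ∧ x ⊕ v ∧ x)
        ≡⟨ cong (s ∧_) (∧-distribʳ u v x) ⟨
      s ∧ s ∧ x
        ≡⟨ ∧-alternating s x ⟩
      0Λ ∎

  -- The coefficient of e₀ ∧ ... ∧ eₙ₋₁. On the wedge of n vectors it is the determinant of the
  -- matrix with these rows.
  top : ∀ {n} → Λ n → ℤ
  top {zero} x = x
  top {suc n} (x , y) = top y

  top-⊕ : ∀ {n} (x y : Λ n) → top (x ⊕ y) ≡ top x + top y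
  top-⊕ {zero} x y = refl
  top-⊕ {suc n} (_ , y) (_ , y′) = top-⊕ y y′

  top-⊙ : ∀ {n} k (x : Λ n) → top (k ⊙ x) ≡ k * top x
  top-⊙ {zero} k x = refl
  top-⊙ {suc n} k (_ , y) = top-⊙ k y

  top-0 : ∀ {n} → top (0Λ {n}) ≡ 0ℤ
  top-0 {zero} = refl
  top-0 {suc n} = top-0 {n}

  -- The last argument stands for the rows further to the right, so that a block of rows can be
  -- transformed in place.
  ⋀ : ∀ {n} → List (Vect n) → Λ n → Λ n
  ⋀ vs x = foldr _∧_ x vs

  ⋀-++ : ∀ {n} (us vs : List (Vect n)) x → ⋀ (us ++ vs) x ≡ ⋀ us (⋀ vs x)
  ⋀-++ [] vs x = refl
  ⋀-++ (u ∷ us) vs x = cong (u ∧_) (⋀-++ us vs x)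

  ⋀-⊕ : ∀ {n} (vs : List (Vect n)) x y → ⋀ vs (x ⊕ y) ≡ ⋀ vs x ⊕ ⋀ vs y
  ⋀-⊕ [] x y = refl
  ⋀-⊕ (v ∷ vs) x y = ≡.trans (cong (v ∧_) (⋀-⊕ vs x y)) (∧-distribˡ v _ _)

  ⋀-⊙ : ∀ {n} (vs : List (Vect n)) k x → ⋀ vs (k ⊙ x) ≡ k ⊙ ⋀ vs x
  ⋀-⊙ [] k x = refl
  ⋀-⊙ (v ∷ vs) k x = ≡.trans (cong (v ∧_) (⋀-⊙ vs k x)) (∧-⊙ v k _)

  -- Anticommuting carries v through us until it meets x; the sign picked up on the way is harmless
  -- because the result is 0.
  ∧-⋀-absent : ∀ {n} (v : Vect n) us x → v ∧ x ≡ 0Λ → v ∧ ⋀ us x ≡ 0Λ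
  ∧-⋀-absent v [] x vx = vx
  ∧-⋀-absent v (u ∷ us) x vx = begin
    v ∧ u ∧ ⋀ us x          ≡⟨ ∧-anticomm v u _ ⟩
    -1ℤ ⊙ u ∧ v ∧ ⋀ us x    ≡⟨ cong (λ y → -1ℤ ⊙ u ∧ y) (∧-⋀-absent v us x vx) ⟩
    -1ℤ ⊙ u ∧ 0Λ            ≡⟨ cong (-1ℤ ⊙_) (∧-zeroʳ u) ⟩
    -1ℤ ⊙ 0Λ                ≡⟨ ⊙-zeroʳ -1ℤ ⟩
    0Λ                      ∎
    where open ≡-Reasoning

  ∧-⋀-∈ : ∀ {n} {v : Vect n} {vs} → v ∈ vs → ∀ x → v ∧ ⋀ vs x ≡ 0Λ
  ∧-⋀-∈ {v = v} (here refl) x = ∧-alternating v _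
  ∧-⋀-∈ {v = v} {u ∷ us} (there v∈us) x = ∧-⋀-absent v (u ∷ []) _ (∧-⋀-∈ v∈us x)

  ⋀-∧-∈ : ∀ {n} {v : Vect n} {vs} → v ∈ vs → ∀ x → ⋀ vs (v ∧ x) ≡ 0Λ
  ⋀-∧-∈ {v = v} {u ∷ us} (here refl) x = ∧-⋀-absent v us _ (∧-alternating v x)
  ⋀-∧-∈ {v = v} {u ∷ us} (there v∈us) x = ≡.trans (cong (u ∧_) (⋀-∧-∈ v∈us x)) (∧-zeroʳ u)

  -- Rows are indexed by labels so that the sign k depends on the permutation alone. Two families r
  -- permuted in the same way then receive the same sign, which cancels when they are compared.
  ⋀-↭ : ∀ {n} {A : Set} {as bs : List A} → as ↭ bs →
    ∃ λ k → ∀ (r : A → Vect n) x → ⋀ (map r as) x ≡ k ⊙ ⋀ (map r bs) x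
  ⋀-↭ refl = 1ℤ , λ r x → sym (⊙-identity _)
  ⋀-↭ (prep a p) with ⋀-↭ p
  ... | k , eq = k , λ r x → ≡.trans (cong (r a ∧_) (eq r x)) (∧-⊙ (r a) k _)
  ⋀-↭ (swap a b p) with ⋀-↭ p
  ... | k , eq = k * -1ℤ , λ r x → begin
      r a ∧ r b ∧ _                   ≡⟨ cong (λ y → r a ∧ r b ∧ y) (eq r x) ⟩
      r a ∧ r b ∧ k ⊙ _               ≡⟨ cong (r a ∧_) (∧-⊙ (r b) k _) ⟩
      r a ∧ k ⊙ r b ∧ _               ≡⟨ ∧-⊙ (r a) k _ ⟩
      k ⊙ r a ∧ r b ∧ _               ≡⟨ cong (k ⊙_) (∧-anticomm (r a) (r b) _) ⟩
      k ⊙ -1ℤ ⊙ r b ∧ r a ∧ _         ≡⟨ ⊙-assoc k -1ℤ _ ⟨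
      (k * -1ℤ) ⊙ r b ∧ r a ∧ _       ∎
    where open ≡-Reasoning
  ⋀-↭ (trans p q) with ⋀-↭ p | ⋀-↭ q
  ... | j , eqⱼ | k , eqₖ = j * k , λ r x →
    ≡.trans (eqⱼ r x) (≡.trans (cong (j ⊙_) (eqₖ r x)) (sym (⊙-assoc j k _)))

  -- Degree, contraction and linear dependence

  -- No component of degree below k. The factor e₀ supplies one degree, hence the smaller bound on
  -- the second component.
  Deg≥ : ∀ {n} → ℕ → Λ n → Set
  Deg≥ zero x = ⊤
  Deg≥ {zero} (suc k) x = x ≡ 0ℤ
  Deg≥ {suc n} (suc k) (x , y) = Deg≥ (suc k) x × Deg≥ k y

  Deg≥-⊕ : ∀ {n} k {x y : Λ n} → Deg≥ k x → Deg≥ k y → Deg≥ k (x ⊕ y)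
  Deg≥-⊕ zero _ _ = tt
  Deg≥-⊕ {zero} (suc k) refl refl = refl
  Deg≥-⊕ {suc n} (suc k) (p , q) (p′ , q′) = Deg≥-⊕ (suc k) p p′ , Deg≥-⊕ k q q′

  Deg≥-⊙ : ∀ {n} k c {x : Λ n} → Deg≥ k x → Deg≥ k (c ⊙ x)
  Deg≥-⊙ zero _ _ = tt
  Deg≥-⊙ {zero} (suc k) c refl = ℤ.*-zeroʳ c
  Deg≥-⊙ {suc n} (suc k) c (p , q) = Deg≥-⊙ (suc k) c p , Deg≥-⊙ k c q

  Deg≥-∧ : ∀ {n} k (v : Vect n) {x} → Deg≥ k x → Deg≥ (suc k) (v ∧ x)
  Deg≥-∧ {zero} k v p = refl
  Deg≥-∧ {suc n} zero v p = Deg≥-∧ 0 (v ∘ suc) tt , tt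
  Deg≥-∧ {suc n} (suc k) v (p , q) = Deg≥-∧ (suc k) (v ∘ suc) p ,
    Deg≥-⊕ (suc k) (Deg≥-⊙ (suc k) (v zero) p) (Deg≥-⊙ (suc k) -1ℤ (Deg≥-∧ k (v ∘ suc) q))

  Deg≥-⋀ : ∀ {n} (vs : List (Vect n)) → Deg≥ (length vs) (⋀ vs 1Λ)
  Deg≥-⋀ [] = tt
  Deg≥-⋀ (v ∷ vs) = Deg≥-∧ (length vs) v (Deg≥-⋀ vs)

  Deg≥-vanish : ∀ {n} {x : Λ n} → Deg≥ (suc n) x → x ≡ 0Λ
  Deg≥-vanish {zero} p = p
  Deg≥-vanish {suc n} (p , q) = cong₂ _,_ (Deg≥-vanish (weaken (suc n) p)) (Deg≥-vanish q)
    where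
    weaken : ∀ {n} k {x : Λ n} → Deg≥ (suc k) x → Deg≥ k x
    weaken zero _ = tt
    weaken {zero} (suc k) p = p
    weaken {suc n} (suc k) (p , q) = weaken (suc k) p , weaken k q

  ⟨_,_⟩ : ∀ {n} → Vect n → Vect n → ℤ
  ⟨_,_⟩ {zero} χ v = 0ℤ
  ⟨_,_⟩ {suc n} χ v = v zero * χ zero + ⟨ χ ∘ suc , v ∘ suc ⟩

  -- Contraction with the functional χ, the antiderivation sending a vector v to `⟨ χ , v ⟩`; the -1
  -- arises from passing e₀.
  _⌟_ : ∀ {n} → Vect n → Λ n → Λ n
  _⌟_ {zero} χ x = 0ℤ
  _⌟_ {suc n} χ (x , y) = (χ ∘ suc) ⌟ x ⊕ χ zero ⊙ y , -1ℤ ⊙ (χ ∘ suc) ⌟ y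

  infixr 7 _⌟_

  ⌟-linear : ∀ {n} (χ : Vect n) k x y → χ ⌟ (x ⊕ k ⊙ y) ≡ χ ⌟ x ⊕ k ⊙ χ ⌟ y
  ⌟-linear {zero} χ k x y = sym (≡.trans (ℤ.+-identityˡ _) (ℤ.*-zeroʳ k))
  ⌟-linear {suc n} χ k (x , y) (x′ , y′) = cong₂ _,_
    (≡.trans (cong (_⊕ _) (⌟-linear (χ ∘ suc) k x x′)) (first k (χ zero) _ _ y y′))
    (≡.trans (cong (-1ℤ ⊙_) (⌟-linear (χ ∘ suc) k y y′)) (second k _ _))
    where
    first : ∀ {n} k g (a b y y′ : Λ n) →
      (a ⊕ k ⊙ b) ⊕ g ⊙ (y ⊕ k ⊙ y′) ≡ (a ⊕ g ⊙ y) ⊕ k ⊙ (b ⊕ g ⊙ y′)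
    first {zero} = solved
      where
      solved : ∀ k g a b y y′ → a + k * b + g * (y + k * y′) ≡ a + g * y + k * (b + g * y′)
      solved = solve-∀
    first {suc n} k g (a , a₁) (b , b₁) (y , y₁) (z , z₁) =
      cong₂ _,_ (first k g a b y z) (first k g a₁ b₁ y₁ z₁)
    second : ∀ {n} k (a b : Λ n) → -1ℤ ⊙ (a ⊕ k ⊙ b) ≡ -1ℤ ⊙ a ⊕ k ⊙ -1ℤ ⊙ b
    second {zero} = solved
      where
      solved : ∀ k a b → -1ℤ * (a + k * b) ≡ -1ℤ * a + k * (-1ℤ * b)
      solved = solve-∀
    second {suc n} k (a , a₁) (b , b₁) = cong₂ _,_ (second k a b) (second k a₁ b₁)

  ⌟-0 : ∀ {n} (χ : Vect n) → χ ⌟ 0Λ ≡ 0Λ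
  ⌟-0 {zero} χ = refl
  ⌟-0 {suc n} χ = cong₂ _,_
    (≡.trans (cong₂ _⊕_ (⌟-0 (χ ∘ suc)) (⊙-zeroʳ (χ zero))) (⊕-identityˡ 0Λ))
    (≡.trans (cong (-1ℤ ⊙_) (⌟-0 (χ ∘ suc))) (⊙-zeroʳ -1ℤ))

  ⌟-1 : ∀ {n} (χ : Vect n) → χ ⌟ 1Λ ≡ 0Λ
  ⌟-1 {zero} χ = refl
  ⌟-1 {suc n} χ = cong₂ _,_
    (≡.trans (cong₂ _⊕_ (⌟-1 (χ ∘ suc)) (⊙-zeroʳ (χ zero))) (⊕-identityˡ 0Λ))
    (≡.trans (cong (-1ℤ ⊙_) (⌟-0 (χ ∘ suc))) (⊙-zeroʳ -1ℤ))

  ⌟-∧ : ∀ {n} (χ v : Vect n) x → χ ⌟ v ∧ x ≡ ⟨ χ , v ⟩ ⊙ x ⊖ v ∧ χ ⌟ x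
  ⌟-∧ {zero} χ v x = sym (cong (_+ 0ℤ) (ℤ.*-zeroˡ x))
  ⌟-∧ {suc n} χ v (x , y) = cong₂ _,_
    (begin
      χ′ ⌟ w ∧ x ⊕ g ⊙ (c ⊙ x ⊖ w ∧ y)
        ≡⟨ cong (_⊕ g ⊙ (c ⊙ x ⊖ w ∧ y)) (⌟-∧ χ′ w x) ⟩
      (d ⊙ x ⊖ w ∧ χ′ ⌟ x) ⊕ g ⊙ (c ⊙ x ⊖ w ∧ y)
        ≡⟨ leibniz₀ c g d x _ _ ⟩
      (c * g + d) ⊙ x ⊖ (w ∧ χ′ ⌟ x ⊕ g ⊙ w ∧ y)
        ≡⟨ cong (λ z → (c * g + d) ⊙ x ⊖ (w ∧ χ′ ⌟ x ⊕ z)) (∧-⊙ w g y) ⟨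
      (c * g + d) ⊙ x ⊖ (w ∧ χ′ ⌟ x ⊕ w ∧ g ⊙ y)
        ≡⟨ cong ((c * g + d) ⊙ x ⊖_) (∧-distribˡ w _ _) ⟨
      (c * g + d) ⊙ x ⊖ w ∧ (χ′ ⌟ x ⊕ g ⊙ y) ∎)
    (begin
      -1ℤ ⊙ χ′ ⌟ (c ⊙ x ⊖ w ∧ y)
        ≡⟨ cong (-1ℤ ⊙_) (⌟-linear χ′ -1ℤ (c ⊙ x) (w ∧ y)) ⟩
      -1ℤ ⊙ (χ′ ⌟ c ⊙ x ⊖ χ′ ⌟ w ∧ y)
        ≡⟨ cong (-1ℤ ⊙_) (cong₂ _⊖_ ⌟-⊙ (⌟-∧ χ′ w y)) ⟩
      -1ℤ ⊙ (c ⊙ χ′ ⌟ x ⊖ (d ⊙ y ⊖ w ∧ χ′ ⌟ y))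
        ≡⟨ leibniz₁ c g d y _ _ ⟩
      (c * g + d) ⊙ y ⊖ (c ⊙ (χ′ ⌟ x ⊕ g ⊙ y) ⊖ -1ℤ ⊙ w ∧ χ′ ⌟ y)
        ≡⟨ cong (λ z → (c * g + d) ⊙ y ⊖ (c ⊙ (χ′ ⌟ x ⊕ g ⊙ y) ⊖ z)) (∧-⊙ w -1ℤ (χ′ ⌟ y)) ⟨
      (c * g + d) ⊙ y ⊖ (c ⊙ (χ′ ⌟ x ⊕ g ⊙ y) ⊖ w ∧ -1ℤ ⊙ χ′ ⌟ y) ∎)
    where
    open ≡-Reasoning
    c = v zero
    g = χ zero
    w = v ∘ suc
    χ′ = χ ∘ suc
    d = ⟨ χ′ , w ⟩
    ⌟-⊙ : χ′ ⌟ c ⊙ x ≡ c ⊙ χ′ ⌟ x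
    ⌟-⊙ = begin
      χ′ ⌟ c ⊙ x              ≡⟨ cong (χ′ ⌟_) (⊕-identityˡ _) ⟨
      χ′ ⌟ (0Λ ⊕ c ⊙ x)       ≡⟨ ⌟-linear χ′ c 0Λ x ⟩
      χ′ ⌟ 0Λ ⊕ c ⊙ χ′ ⌟ x    ≡⟨ cong (_⊕ c ⊙ χ′ ⌟ x) (⌟-0 χ′) ⟩
      0Λ ⊕ c ⊙ χ′ ⌟ x         ≡⟨ ⊕-identityˡ _ ⟩
      c ⊙ χ′ ⌟ x              ∎

  ⌟-⋀ : ∀ {n} (χ : Vect n) vs → All (λ v → ⟨ χ , v ⟩ ≡ 0ℤ) vs → χ ⌟ ⋀ vs 1Λ ≡ 0Λ
  ⌟-⋀ χ [] [] = ⌟-1 χ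
  ⌟-⋀ χ (v ∷ vs) (χv≡0 ∷ p) = begin
    χ ⌟ v ∧ ⋀ vs 1Λ                              ≡⟨ ⌟-∧ χ v _ ⟩
    ⟨ χ , v ⟩ ⊙ ⋀ vs 1Λ ⊖ v ∧ χ ⌟ ⋀ vs 1Λ        ≡⟨ cong₂ (λ k x → k ⊙ ⋀ vs 1Λ ⊖ v ∧ x) χv≡0 (⌟-⋀ χ vs p) ⟩
    0ℤ ⊙ ⋀ vs 1Λ ⊖ v ∧ 0Λ                        ≡⟨ cong₂ _⊖_ (⊙-zeroˡ _) (∧-zeroʳ v) ⟩
    0Λ ⊖ 0Λ                                      ≡⟨ ⊖-self 0Λ ⟩
    0Λ                                           ∎
    where open ≡-Reasoning

  -- Contracting z ∧ ⋀ vs, which vanishes for reasons of degree, by χ leaves ⟨ χ , z ⟩ ⊙ ⋀ vs.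
  ⋀-dependent : ∀ {n} (χ z : Vect n) vs → length vs ≡ n → ⟨ χ , z ⟩ ≡ 1ℤ →
    All (λ v → ⟨ χ , v ⟩ ≡ 0ℤ) vs → ⋀ vs 1Λ ≡ 0Λ
  ⋀-dependent χ z vs len χz≡1 p = begin
    ω                                  ≡⟨ ⊙-identity ω ⟨
    1ℤ ⊙ ω                             ≡⟨ ⊕-identityʳ _ ⟨
    1ℤ ⊙ ω ⊕ 0Λ                        ≡⟨ cong (1ℤ ⊙ ω ⊕_) (⊙-zeroʳ -1ℤ) ⟨
    1ℤ ⊙ ω ⊖ 0Λ                        ≡⟨ cong (1ℤ ⊙ ω ⊖_) (∧-zeroʳ z) ⟨
    1ℤ ⊙ ω ⊖ z ∧ 0Λ                    ≡⟨ cong₂ (λ k x → k ⊙ ω ⊖ z ∧ x) χz≡1 (⌟-⋀ χ vs p) ⟨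
    ⟨ χ , z ⟩ ⊙ ω ⊖ z ∧ χ ⌟ ω          ≡⟨ ⌟-∧ χ z ω ⟨
    χ ⌟ z ∧ ω                          ≡⟨ cong (χ ⌟_) (Deg≥-vanish (subst (λ k → Deg≥ (suc k) (z ∧ ω)) len (Deg≥-⋀ (z ∷ vs)))) ⟩
    χ ⌟ 0Λ                             ≡⟨ ⌟-0 χ ⟩
    0Λ                                 ∎
    where
    open ≡-Reasoning
    ω = ⋀ vs 1Λ

  e : ∀ {n} → Fin n → Vect n
  e zero zero = 1ℤ
  e zero (suc j) = 0ℤ
  e (suc i) zero = 0ℤ
  e (suc i) (suc j) = e i j

  ⟨⟩-zero : ∀ {n} (χ : Vect n) → ⟨ χ , (λ _ → 0ℤ) ⟩ ≡ 0ℤ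
  ⟨⟩-zero {zero} χ = refl
  ⟨⟩-zero {suc n} χ = cong₂ _+_ (ℤ.*-zeroˡ (χ zero)) (⟨⟩-zero (χ ∘ suc))

  ⟨⟩-e : ∀ {n} (χ : Vect n) i → ⟨ χ , e i ⟩ ≡ χ i
  ⟨⟩-e {suc n} χ zero = begin
    1ℤ * χ zero + ⟨ χ ∘ suc , e zero ∘ suc ⟩  ≡⟨ cong₂ _+_ (ℤ.*-identityˡ (χ zero)) (⟨⟩-zero (χ ∘ suc)) ⟩
    χ zero + 0ℤ                               ≡⟨ ℤ.+-identityʳ _ ⟩
    χ zero                                    ∎
    where
    open ≡-Reasoning
  ⟨⟩-e {suc n} χ (suc i) =
    ≡.trans (cong₂ _+_ (ℤ.*-zeroˡ (χ zero)) (⟨⟩-e (χ ∘ suc) i)) (ℤ.+-identityˡ _)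

  ⟨⟩-minus : ∀ {n} (χ u v : Vect n) → ⟨ χ , (λ i → u i - v i) ⟩ ≡ ⟨ χ , u ⟩ - ⟨ χ , v ⟩
  ⟨⟩-minus {zero} χ u v = refl
  ⟨⟩-minus {suc n} χ u v =
    ≡.trans (cong ((u zero - v zero) * χ zero +_) (⟨⟩-minus (χ ∘ suc) (u ∘ suc) (v ∘ suc)))
            (solved (u zero) (v zero) (χ zero) ⟨ χ ∘ suc , u ∘ suc ⟩ ⟨ χ ∘ suc , v ∘ suc ⟩)
    where
    solved : ∀ a b g s t → (a - b) * g + (s - t) ≡ a * g + s - (b * g + t)
    solved = solve-∀

-- The matrix-tree theorem in terms of parent vectors

module ParentVectors where

  open ExteriorAlgebra
  open import Data.Nat as ℕ using (ℕ; zero; suc; z≤n; s≤s; _∸_)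
  import Data.Nat.Properties as ℕ
  open import Data.Integer using (ℤ; 0ℤ; 1ℤ; -1ℤ; +_; _+_; _*_; -_; _-_)
  import Data.Integer.Properties as ℤ
  open import Data.Fin using (Fin; zero; suc; toℕ)
  import Data.Fin.Properties as Fin
  open import Data.List using (List; []; _∷_; _++_; foldr; map; length; filter; allFin; tabulate; cartesianProductWith)
  open import Data.List.Properties using (map-tabulate; length-tabulate; length-++; length-map)
  open import Data.List.Membership.Propositional using (_∈_)
  open import Data.List.Membership.Propositional.Properties using (∈-allFin; ∈-map⁺; ∈-cartesianProductWith⁺; ∈-cartesianProductWith⁻)
  open import Data.List.Relation.Unary.Any using (here; there)
  open import Data.List.Relation.Unary.All as All using (All; []; _∷_)
  import Data.List.Relation.Unary.All.Properties as All
  open import Data.List.Relation.Unary.AllPairs using (AllPairs; []; _∷_)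
  open import Data.List.Relation.Unary.Unique.Propositional using (Unique)
  import Data.List.Relation.Unary.Unique.Propositional.Properties as Unique
  open import Data.List.Relation.Unary.Sorted.TotalOrder.Properties using (Sorted⇒AllPairs)
  open import Data.List.Relation.Binary.Permutation.Propositional using (↭-sym)
  open import Data.List.Relation.Binary.Permutation.Propositional.Properties using (∈-resp-↭)
  open import Data.List.Sort using (sort; sort-↭; sort-↗)
  open import Data.Vec using (Vec; []; _∷_; lookup)
  open import Data.Vec.Properties using (∷-injective)
  open import Data.Product using (_×_; _,_; ∃; proj₁; proj₂)
  open import Data.Sum using (_⊎_; inj₁; inj₂)
  open import Function using (_∘_; id)
  open import Relation.Binary using (DecTotalOrder)
  import Relation.Binary.Construct.On as On
  import Relation.Binary.Construct.Flip.EqAndOrd as Flip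
  open import Relation.Binary.PropositionalEquality
    using (_≡_; _≢_; refl; sym; trans; cong; cong₂; subst; module ≡-Reasoning)
  open import Relation.Nullary using (¬_; yes; no; contradiction)
  open import Relation.Unary using (Decidable)

  ∑ : {A : Set} → List A → (A → ℤ) → ℤ
  ∑ as g = foldr (λ a s → g a + s) 0ℤ as

  ⨁ : {A : Set} → ∀ {n} → List A → (A → Λ n) → Λ n
  ⨁ as g = foldr (λ a s → g a ⊕ s) 0Λ as

  ∑-∧ : ∀ {A : Set} {n} as (g : A → Vect n) x → (λ k → ∑ as (λ a → g a k)) ∧ x ≡ ⨁ as (λ a → g a ∧ x)
  ∑-∧ [] g x = ∧-zeroˡ _ (λ _ → refl) x
  ∑-∧ (a ∷ as) g x = trans (∧-distribʳ (g a) _ x) (cong (g a ∧ x ⊕_) (∑-∧ as g x))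

  ∧-⨁ : ∀ {A : Set} {n} (v : Vect n) as (g : A → Λ n) → v ∧ ⨁ as g ≡ ⨁ as (λ a → v ∧ g a)
  ∧-⨁ v [] g = ∧-zeroʳ v
  ∧-⨁ v (a ∷ as) g = trans (∧-distribˡ v _ _) (cong (v ∧ g a ⊕_) (∧-⨁ v as g))

  top-⨁ : ∀ {A : Set} {n} as (g : A → Λ n) → top (⨁ as g) ≡ ∑ as (top ∘ g)
  top-⨁ {n = n} [] g = top-0 {n}
  top-⨁ (a ∷ as) g = trans (top-⊕ (g a) _) (cong (λ s → top (g a) + s) (top-⨁ as g))

  ⨁-cong : ∀ {A : Set} {n} as {g h : A → Λ n} → (∀ a → g a ≡ h a) → ⨁ as g ≡ ⨁ as h
  ⨁-cong [] eq = refl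
  ⨁-cong (a ∷ as) eq = cong₂ _⊕_ (eq a) (⨁-cong as eq)

  ⨁-++ : ∀ {A : Set} {n} as bs (g : A → Λ n) → ⨁ (as ++ bs) g ≡ ⨁ as g ⊕ ⨁ bs g
  ⨁-++ [] bs g = sym (⊕-identityˡ _)
  ⨁-++ (a ∷ as) bs g = trans (cong (g a ⊕_) (⨁-++ as bs g)) (sym (⊕-assoc (g a) _ _))

  ⨁-map : ∀ {A B : Set} {n} (h : A → B) as (g : B → Λ n) → ⨁ (map h as) g ≡ ⨁ as (g ∘ h)
  ⨁-map h [] g = refl
  ⨁-map h (a ∷ as) g = cong (g (h a) ⊕_) (⨁-map h as g)

  ⨁-cartesian : ∀ {A B C : Set} {n} (p : A → B → C) as bs (g : C → Λ n) →
    ⨁ (cartesianProductWith p as bs) g ≡ ⨁ as (λ a → ⨁ bs (λ b → g (p a b)))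
  ⨁-cartesian p [] bs g = refl
  ⨁-cartesian p (a ∷ as) bs g = trans (⨁-++ (map (p a) bs) _ g)
    (cong₂ _⊕_ (⨁-map (p a) bs g) (⨁-cartesian p as bs g))

  ∑-indicator : ∀ {A : Set} {P : A → Set} (P? : Decidable P) (h : A → ℤ) →
    (∀ a → P a → h a ≡ 1ℤ) → (∀ a → ¬ P a → h a ≡ 0ℤ) →
    ∀ as → ∑ as h ≡ + length (filter P? as)
  ∑-indicator P? h one zer [] = refl
  ∑-indicator P? h one zer (a ∷ as) with P? a
  ... | yes p = cong₂ _+_ (one a p) (∑-indicator P? h one zer as)
  ... | no ¬p = trans (cong₂ _+_ (zer a ¬p) (∑-indicator P? h one zer as)) (ℤ.+-identityˡ _)

  choices : ∀ {A : Set} {n} → (Fin n → List A) → List (Vec A n)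
  choices {n = zero} F = [] ∷ []
  choices {n = suc n} F = cartesianProductWith _∷_ (F zero) (choices (F ∘ suc))

  -- Multilinearity. A Laplacian row is a sum over neighbours, so the determinant becomes a sum over
  -- the ways to choose one neighbour for every vertex other than the root.
  ⋀-expand : ∀ {A : Set} {n m} (F : Fin m → List A) (g : Fin m → A → Vect n) x →
    ⋀ (tabulate (λ i k → ∑ (F i) (λ a → g i a k))) x ≡
    ⨁ (choices F) (λ f → ⋀ (tabulate (λ i → g i (lookup f i))) x)
  ⋀-expand {m = zero} F g x = sym (⊕-identityʳ x)
  ⋀-expand {A} {n} {suc m} F g x = begin
    (λ k → ∑ (F zero) (λ a → g zero a k)) ∧ ⋀ (tabulate (λ i k → ∑ (F (suc i)) (λ a → g (suc i) a k))) x
      ≡⟨ cong (_ ∧_) (⋀-expand (F ∘ suc) (g ∘ suc) x) ⟩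
    (λ k → ∑ (F zero) (λ a → g zero a k)) ∧ ⨁ (choices (F ∘ suc)) rest
      ≡⟨ ∑-∧ (F zero) (g zero) _ ⟩
    ⨁ (F zero) (λ a → g zero a ∧ ⨁ (choices (F ∘ suc)) rest)
      ≡⟨ ⨁-cong (F zero) (λ a → ∧-⨁ (g zero a) (choices (F ∘ suc)) rest) ⟩
    ⨁ (F zero) (λ a → ⨁ (choices (F ∘ suc)) (λ f → g zero a ∧ rest f))
      ≡⟨ ⨁-cartesian _∷_ (F zero) (choices (F ∘ suc)) _ ⟨
    ⨁ (choices F) (λ f → ⋀ (tabulate (λ i → g i (lookup f i))) x) ∎
    where
    open ≡-Reasoning
    rest : Vec A m → Λ n
    rest f = ⋀ (tabulate (λ i → g (suc i) (lookup f i))) x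

  ∈-choices⁺ : ∀ {A : Set} {n} (F : Fin n → List A) f → (∀ i → lookup f i ∈ F i) → f ∈ choices F
  ∈-choices⁺ F [] p = here refl
  ∈-choices⁺ F (a ∷ f) p =
    ∈-cartesianProductWith⁺ _∷_ (p zero) (∈-choices⁺ (F ∘ suc) f (p ∘ suc))

  ∈-choices⁻ : ∀ {A : Set} {n} (F : Fin n → List A) f → f ∈ choices F → ∀ i → lookup f i ∈ F i
  ∈-choices⁻ F (a ∷ f) p i with ∈-cartesianProductWith⁻ _∷_ (F zero) (choices (F ∘ suc)) p
  ∈-choices⁻ F (a ∷ f) p zero | _ , _ , q , r , refl = q
  ∈-choices⁻ F (a ∷ f) p (suc i) | _ , _ , q , r , refl = ∈-choices⁻ (F ∘ suc) f r i

  choices-unique : ∀ {A : Set} {n} (F : Fin n → List A) → (∀ i → Unique (F i)) → Unique (choices F)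
  choices-unique {n = zero} F u = [] ∷ []
  choices-unique {n = suc n} F u =
    Unique.cartesianProductWith⁺ _∷_ ∷-injective (u zero) (choices-unique (F ∘ suc) (u ∘ suc))

  length-cartesianProductWith : ∀ {A B C : Set} (p : A → B → C) as bs →
    length (cartesianProductWith p as bs) ≡ length as ℕ.* length bs
  length-cartesianProductWith p [] bs = refl
  length-cartesianProductWith p (a ∷ as) bs = trans (length-++ (map (p a) bs))
    (cong₂ ℕ._+_ (length-map (p a) bs) (length-cartesianProductWith p as bs))

  length-choices : ∀ {A : Set} {n} (F : Fin n → List A) b → (∀ i → length (F i) ℕ.≤ b) →
    length (choices F) ℕ.≤ b ℕ.^ n
  length-choices {n = zero} F b p = s≤s z≤n
  length-choices {n = suc n} F b p = subst (ℕ._≤ b ℕ.^ suc n)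
    (sym (length-cartesianProductWith _∷_ (F zero) _))
    (ℕ.*-mono-≤ (p zero) (length-choices (F ∘ suc) b (p ∘ suc)))

  volume : ∀ n → Λ n
  volume n = ⋀ (tabulate e) 1Λ

  -- Vertex zero is the root; f lists the parents of the other vertices.
  module _ {N : ℕ} where

    parent : Vec (Fin (suc N)) N → Fin (suc N) → Fin (suc N)
    parent f zero = zero
    parent f (suc i) = lookup f i

    ancestor : Vec (Fin (suc N)) N → ℕ → Fin (suc N) → Fin (suc N)
    ancestor f zero x = x
    ancestor f (suc k) x = ancestor f k (parent f x)

    -- The fixed number N of steps makes the property decidable. It excludes nothing:
    -- `ancestor-stable` shows that a vertex which ever reaches the root does so by then.
    Acyclic : Vec (Fin (suc N)) N → Set
    Acyclic f = ∀ x → ancestor f N x ≡ zero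

    acyclic? : Decidable Acyclic
    acyclic? f = Fin.all? (λ x → ancestor f N x Fin.≟ zero)

    ancestor-root : ∀ f k → ancestor f k zero ≡ zero
    ancestor-root f zero = refl
    ancestor-root f (suc k) = ancestor-root f k

    ancestor-+ : ∀ f j k x → ancestor f (j ℕ.+ k) x ≡ ancestor f k (ancestor f j x)
    ancestor-+ f zero k x = refl
    ancestor-+ f (suc j) k x = ancestor-+ f j k (parent f x)

    ancestor-≤ : ∀ f {j k} x → j ℕ.≤ k → ancestor f j x ≡ zero → ancestor f k x ≡ zero
    ancestor-≤ f {j} {k} x j≤k eq = begin
      ancestor f k x                          ≡⟨ cong (λ l → ancestor f l x) (ℕ.m+[n∸m]≡n j≤k) ⟨
      ancestor f (j ℕ.+ (k ∸ j)) x            ≡⟨ ancestor-+ f j (k ∸ j) x ⟩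
      ancestor f (k ∸ j) (ancestor f j x)     ≡⟨ cong (ancestor f (k ∸ j)) eq ⟩
      ancestor f (k ∸ j) zero                 ≡⟨ ancestor-root f (k ∸ j) ⟩
      zero                                    ∎
      where open ≡-Reasoning

    -- By the pigeonhole principle a vertex reaching the root does so within N steps.
    ancestor-stable : ∀ f x → ancestor f (suc N) x ≡ zero → ancestor f N x ≡ zero
    ancestor-stable f x eq
      with i , j , i<j , same ← Fin.pigeonhole {suc N} {suc (suc N)} (ℕ.n<1+n _) (λ t → ancestor f (toℕ t) x) =
      -- The loop between steps i and j is cut out of a walk of N + 1 steps, which leaves at most N.
      ancestor-≤ f x shorter (begin
        ancestor f (toℕ i ℕ.+ (suc N ∸ toℕ j)) x          ≡⟨ ancestor-+ f (toℕ i) _ x ⟩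
        ancestor f (suc N ∸ toℕ j) (ancestor f (toℕ i) x) ≡⟨ cong (ancestor f (suc N ∸ toℕ j)) same ⟩
        ancestor f (suc N ∸ toℕ j) (ancestor f (toℕ j) x) ≡⟨ ancestor-+ f (toℕ j) _ x ⟨
        ancestor f (toℕ j ℕ.+ (suc N ∸ toℕ j)) x          ≡⟨ cong (λ l → ancestor f l x) (ℕ.m+[n∸m]≡n j≤) ⟩
        ancestor f (suc N) x                              ≡⟨ eq ⟩
        zero                                              ∎)
      where
      open ≡-Reasoning
      j≤ : toℕ j ℕ.≤ suc N
      j≤ = Fin.toℕ≤pred[n] j
      shorter : toℕ i ℕ.+ (suc N ∸ toℕ j) ℕ.≤ N
      shorter = ℕ.≤-pred (subst (suc (toℕ i ℕ.+ (suc N ∸ toℕ j)) ℕ.≤_) (ℕ.m+[n∸m]≡n j≤)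
                            (ℕ.+-monoˡ-≤ (suc N ∸ toℕ j) i<j))

    depth′ : Vec (Fin (suc N)) N → ℕ → Fin (suc N) → ℕ
    depth′ f zero x = 0
    depth′ f (suc k) zero = 0
    depth′ f (suc k) (suc i) = suc (depth′ f k (lookup f i))

    depth : Vec (Fin (suc N)) N → Fin (suc N) → ℕ
    depth f = depth′ f N

    -- Unfolding the depth of a child once consumes one unit of fuel; stability between N and N + 1
    -- repays it in `depth-parent`.
    depth′-stable : ∀ f k x → ancestor f k x ≡ zero → depth′ f (suc k) x ≡ depth′ f k x
    depth′-stable f zero zero eq = refl
    depth′-stable f (suc k) zero eq = refl
    depth′-stable f (suc k) (suc i) eq = cong suc (depth′-stable f k (lookup f i) eq)

    depth-parent : ∀ f → Acyclic f → ∀ i → depth f (suc i) ≡ suc (depth f (lookup f i))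
    depth-parent f ac i = sym (depth′-stable f N (suc i) (ac (suc i)))

    -- Sending the root to 0 deletes its column, so that the sums of `link` over neighbours are the
    -- rows of the reduced Laplacian.
    E : Fin (suc N) → Vect N
    E zero k = 0ℤ
    E (suc i) k = e i k

    link : Fin N → Fin (suc N) → Vect N
    link i y k = e i k - E y k

    -- With the vertices sorted by decreasing depth the matrix with rows link i (lookup f i) is
    -- unitriangular.
    ⋀-acyclic : ∀ f → Acyclic f → ⋀ (tabulate (λ i → link i (lookup f i))) 1Λ ≡ volume N
    ⋀-acyclic f ac = begin
      ⋀ (tabulate r) 1Λ           ≡⟨ cong (λ vs → ⋀ vs 1Λ) (map-tabulate id r) ⟨
      ⋀ (map r (allFin N)) 1Λ     ≡⟨ proj₂ permute r 1Λ ⟩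
      k ⊙ ⋀ (map r is) 1Λ         ≡⟨ cong (k ⊙_) (triangular is sorted closed) ⟩
      k ⊙ ⋀ (map e is) 1Λ         ≡⟨ proj₂ permute e 1Λ ⟨
      ⋀ (map e (allFin N)) 1Λ     ≡⟨ cong (λ vs → ⋀ vs 1Λ) (map-tabulate id e) ⟩
      volume N                    ∎
      where
      open ≡-Reasoning
      r : Fin N → Vect N
      r i = link i (lookup f i)
      order : DecTotalOrder _ _ _
      order = On.decTotalOrder (Flip.decTotalOrder ℕ.≤-decTotalOrder) (λ i → depth f (suc i))
      is : List (Fin N)
      is = sort order (allFin N)
      permute = ⋀-↭ {N} (↭-sym (sort-↭ order (allFin N)))
      k = proj₁ permute
      sorted : AllPairs (λ i j → depth f (suc j) ℕ.≤ depth f (suc i)) is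
      sorted = Sorted⇒AllPairs (DecTotalOrder.totalOrder order) (sort-↗ order (allFin N))
      ParentIn : List (Fin N) → Fin N → Set
      ParentIn js i = lookup f i ≡ zero ⊎ ∃ λ j → lookup f i ≡ suc j × j ∈ js
      closed : ∀ {i} → i ∈ is → ParentIn is i
      closed {i} _ with lookup f i
      ... | zero = inj₁ refl
      ... | suc j = inj₂ (j , refl , ∈-resp-↭ (↭-sym (sort-↭ order (allFin N))) (∈-allFin j))
      deeper : ∀ {i j} → lookup f i ≡ suc j → depth f (suc j) ℕ.< depth f (suc i)
      deeper {i} eq = subst (λ y → depth f y ℕ.< depth f (suc i)) eq
        (ℕ.≤-reflexive (sym (depth-parent f ac i)))
      triangular : ∀ is → AllPairs (λ i j → depth f (suc j) ℕ.≤ depth f (suc i)) is →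
        (∀ {i} → i ∈ is → ParentIn is i) → ⋀ (map r is) 1Λ ≡ ⋀ (map e is) 1Λ
      triangular [] _ _ = refl
      triangular (i ∷ is) (i≥ ∷ sorted) closed = begin
        r i ∧ ⋀ (map r is) 1Λ
          ≡⟨ cong (r i ∧_) (triangular is sorted closed′) ⟩
        r i ∧ tail
          ≡⟨ ∧-cong (λ k → cong (λ c → e i k + c) (sym (ℤ.-1*i≡-i (E (lookup f i) k)))) tail ⟩
        (λ k → e i k + -1ℤ * E (lookup f i) k) ∧ tail
          ≡⟨ ∧-distribʳ (e i) _ tail ⟩
        e i ∧ tail ⊕ (λ k → -1ℤ * E (lookup f i) k) ∧ tail
          ≡⟨ cong (e i ∧ tail ⊕_) (*-∧ -1ℤ (E (lookup f i)) tail) ⟩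
        e i ∧ tail ⊕ -1ℤ ⊙ E (lookup f i) ∧ tail
          ≡⟨ cong (λ x → e i ∧ tail ⊕ -1ℤ ⊙ x) (absorbed (closed (here refl))) ⟩
        e i ∧ tail ⊕ -1ℤ ⊙ 0Λ
          ≡⟨ cong (e i ∧ tail ⊕_) (⊙-zeroʳ -1ℤ) ⟩
        e i ∧ tail ⊕ 0Λ
          ≡⟨ ⊕-identityʳ _ ⟩
        e i ∧ tail ∎
        where
        tail = ⋀ (map e is) 1Λ
        closed′ : ∀ {j} → j ∈ is → ParentIn is j
        closed′ {j} j∈ with closed (there j∈)
        ... | inj₁ root = inj₁ root
        ... | inj₂ (_ , eq , there p) = inj₂ (_ , eq , p)
        -- The removed head i is at least as deep as every later j, so it cannot be the parent of j.
        ... | inj₂ (_ , eq , here refl) =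
          contradiction (All.lookup i≥ j∈) (ℕ.<⇒≱ (deeper {j} eq))
        absorbed : ParentIn (i ∷ is) i → E (lookup f i) ∧ tail ≡ 0Λ
        absorbed (inj₁ root) = trans (cong (λ y → E y ∧ tail) root) (∧-zeroˡ (E zero) (λ _ → refl) tail)
        absorbed (inj₂ (j , eq , there p)) =
          trans (cong (λ y → E y ∧ tail) eq) (∧-⋀-∈ (∈-map⁺ e p) 1Λ)
        absorbed (inj₂ (j , eq , here refl)) = contradiction (deeper {i} eq) (ℕ.<-irrefl refl)

    -- The indicator of the vertices that never reach the root annihilates every row.
    ⋀-cyclic : ∀ f → ¬ Acyclic f → ⋀ (tabulate (λ i → link i (lookup f i))) 1Λ ≡ 0Λ
    ⋀-cyclic f ¬ac with Fin.¬∀⟶∃¬ (suc N) _ (λ x → ancestor f N x Fin.≟ zero) ¬ac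
    ... | zero , lost = contradiction (ancestor-root f N) lost
    ... | suc s , lost = ⋀-dependent χ (e s) (tabulate (λ i → link i (lookup f i))) (length-tabulate _)
        (trans (⟨⟩-e χ s) (lost-1 (suc s) lost))
        (All.tabulate⁺ λ i → begin
          ⟨ χ , link i (lookup f i) ⟩          ≡⟨ ⟨⟩-minus χ (e i) (E (lookup f i)) ⟩
          ⟨ χ , e i ⟩ - ⟨ χ , E (lookup f i) ⟩ ≡⟨ cong₂ _-_ (⟨⟩-e χ i) (⟨⟩-E (lookup f i)) ⟩
          χ′ (suc i) - χ′ (lookup f i)         ≡⟨ cong (λ c → χ′ (suc i) - c) (invariant i) ⟨
          χ′ (suc i) - χ′ (suc i)              ≡⟨ ℤ.+-inverseʳ (χ′ (suc i)) ⟩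
          0ℤ                                   ∎)
      where
      open ≡-Reasoning
      χ′ : Fin (suc N) → ℤ
      χ′ x with ancestor f N x Fin.≟ zero
      ... | yes _ = 0ℤ
      ... | no _ = 1ℤ
      χ : Vect N
      χ i = χ′ (suc i)
      lost-1 : ∀ x → ancestor f N x ≢ zero → χ′ x ≡ 1ℤ
      lost-1 x p with ancestor f N x Fin.≟ zero
      ... | yes q = contradiction q p
      ... | no _ = refl
      found-0 : ∀ x → ancestor f N x ≡ zero → χ′ x ≡ 0ℤ
      found-0 x p with ancestor f N x Fin.≟ zero
      ... | yes _ = refl
      ... | no q = contradiction p q
      ⟨⟩-E : ∀ x → ⟨ χ , E x ⟩ ≡ χ′ x
      ⟨⟩-E zero = trans (⟨⟩-zero χ) (sym (found-0 zero (ancestor-root f N)))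
      ⟨⟩-E (suc i) = ⟨⟩-e χ i
      invariant : ∀ i → χ′ (suc i) ≡ χ′ (lookup f i)
      invariant i with ancestor f N (suc i) Fin.≟ zero
      ... | yes p = sym (found-0 (lookup f i) (ancestor-≤ f (suc i) (ℕ.n≤1+n N) p))
      ... | no ¬p = sym (lost-1 (lookup f i) (λ q → ¬p (ancestor-stable f (suc i) q)))

  ⋀-lift : ∀ {n m} (g : Fin m → Vect (suc n)) → (∀ i → g i zero ≡ 0ℤ) → ∀ x →
    ⋀ (tabulate g) (x , 0Λ) ≡ (⋀ (tabulate (λ i → g i ∘ suc)) x , 0Λ)
  ⋀-lift {m = zero} g g₀ x = refl
  ⋀-lift {n} {suc m} g g₀ x = trans (cong (g zero ∧_) (⋀-lift (g ∘ suc) (g₀ ∘ suc) x))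
    (cong (((g zero ∘ suc) ∧ y) ,_) (begin
      g zero zero ⊙ y ⊖ (g zero ∘ suc) ∧ 0Λ   ≡⟨ cong₂ (λ c z → c ⊙ y ⊖ z) (g₀ zero) (∧-zeroʳ (g zero ∘ suc)) ⟩
      0ℤ ⊙ y ⊖ 0Λ                             ≡⟨ cong (_⊖ 0Λ) (⊙-zeroˡ y) ⟩
      0Λ ⊖ 0Λ                                 ≡⟨ ⊖-self {n} 0Λ ⟩
      0Λ                                      ∎))
    where
    open ≡-Reasoning
    y : Λ n
    y = ⋀ (tabulate (λ i → g (suc i) ∘ suc)) x

  top-volume : ∀ n → top (volume n) ≡ 1ℤ
  top-volume zero = refl
  top-volume (suc n) = begin
    top (volume (suc n))               ≡⟨ cong (λ x → top (_∧_ {suc n} (e zero) x)) (⋀-lift (e ∘ suc) (λ _ → refl) 1Λ) ⟩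
    top (1ℤ ⊙ volume n ⊖ z ∧ 0Λ)       ≡⟨ cong₂ (λ x y → top (x ⊖ y)) (⊙-identity (volume n)) (∧-zeroʳ z) ⟩
    top (volume n ⊕ -1ℤ ⊙ 0Λ)          ≡⟨ cong (λ x → top (volume n ⊕ x)) (⊙-zeroʳ -1ℤ) ⟩
    top (volume n ⊕ 0Λ)                ≡⟨ cong top (⊕-identityʳ (volume n)) ⟩
    top (volume n)                     ≡⟨ top-volume n ⟩
    1ℤ                                 ∎
    where
    open ≡-Reasoning
    z : Vect n
    z j = 0ℤ

  treeCount : ∀ {N} → (Fin N → List (Fin (suc N))) → ℕ
  treeCount F = length (filter acyclic? (choices F))

  -- Each term of `⋀-expand` is the determinant belonging to one parent vector: 1 by `⋀-acyclic`, or
  -- 0 by `⋀-cyclic`. No cancellation between terms takes place.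
  top-laplacian : ∀ {N} (F : Fin N → List (Fin (suc N))) →
    top (⋀ (tabulate (λ i k → ∑ (F i) (λ y → link i y k))) 1Λ) ≡ + treeCount F
  top-laplacian {N} F = begin
    top (⋀ (tabulate (λ i k → ∑ (F i) (λ y → link i y k))) 1Λ)  ≡⟨ cong top (⋀-expand F link 1Λ) ⟩
    top (⨁ (choices F) rows)                                    ≡⟨ top-⨁ (choices F) rows ⟩
    ∑ (choices F) (top ∘ rows)                                  ≡⟨ ∑-indicator acyclic? (top ∘ rows)
      (λ f ac → trans (cong top (⋀-acyclic f ac)) (top-volume N))
      (λ f ¬ac → trans (cong top (⋀-cyclic f ¬ac)) (top-0 {N})) (choices F) ⟩
    + treeCount F                                               ∎
    where
    open ≡-Reasoning
    rows : Vec (Fin (suc N)) N → Λ N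
    rows f = ⋀ (tabulate (λ i → link i (lookup f i))) 1Λ

-- Spanning trees correspond to acyclic parent vectors

module SpanningTrees where

  open import Defs
  open ParentVectors
  open import Data.Bool as Bool using (Bool; true; false)
  import Data.Bool.Properties as Bool
  open import Data.Nat as ℕ using (ℕ; zero; suc; z≤n; s≤s)
  import Data.Nat.Properties as ℕ
  open import Data.Fin using (Fin; zero; suc)
  import Data.Fin.Properties as Fin
  open import Data.List using (List; []; _∷_; _++_; map; length; filter; allFin)
  open import Data.List.Properties using (length-map; length-filter; length-tabulate)
  open import Data.List.Membership.Propositional using (_∈_)
  open import Data.List.Membership.Propositional.Properties
    using (∈-allFin; ∈-map⁺; ∈-map⁻; ∈-filter⁺; ∈-filter⁻)
  open import Data.List.Relation.Unary.Any using (here; there; any?)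
  open import Data.List.Relation.Unary.All as All using (All; []; _∷_)
  import Data.List.Relation.Unary.All.Properties as All
  open import Data.List.Relation.Unary.AllPairs using ([]; _∷_)
  open import Data.List.Relation.Unary.Linked as Linked using (Linked; []; [-]; _∷_)
  open import Data.List.Relation.Unary.Unique.Propositional using (Unique)
  import Data.List.Relation.Unary.Unique.Propositional.Properties as Unique
  open import Data.Vec as Vec using (Vec; []; _∷_; lookup)
  open import Data.Vec.Properties using (lookup∘tabulate)
  open import Data.Product using (_×_; _,_; ∃; proj₁; proj₂)
  open import Data.Sum as Sum using (_⊎_; inj₁; inj₂)
  open import Data.Unit using (⊤; tt)
  open import Function using (_∘_; id; mk⇔)
  open import Relation.Binary.PropositionalEquality
    using (_≡_; _≢_; refl; sym; trans; cong; cong₂; subst)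
  open import Relation.Nullary using (¬_; Dec; yes; no; contradiction; does; _⊎-dec_; _×-dec_; map′)
  open import Relation.Unary using (Decidable)

  bool-ext : ∀ {a b} → (a ≡ true → b ≡ true) → (b ≡ true → a ≡ true) → a ≡ b
  bool-ext {false} {false} _ _ = refl
  bool-ext {false} {true} _ g = g refl
  bool-ext {true} {b} f _ = sym (f refl)

  does⁻ : ∀ {P : Set} (P? : Dec P) → does P? ≡ true → P
  does⁻ (yes p) _ = p

  does⁺ : ∀ {P : Set} (P? : Dec P) → P → does P? ≡ true
  does⁺ (yes _) _ = refl
  does⁺ (no ¬p) p = contradiction p ¬p

  vec-ext : ∀ {A : Set} {n} {u v : Vec A n} → (∀ i → lookup u i ≡ lookup v i) → u ≡ v
  vec-ext {u = []} {[]} _ = refl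
  vec-ext {u = _ ∷ _} {_ ∷ _} eq = cong₂ _∷_ (eq zero) (vec-ext (eq ∘ suc))

  adj-ext : ∀ {n} {A B : Adj n} → (∀ x y → adj A x y ≡ adj B x y) → A ≡ B
  adj-ext eq = vec-ext (λ x → vec-ext (eq x))

  matrix : ∀ {n} → (Fin n → Fin n → Bool) → Adj n
  matrix b = Vec.tabulate (λ x → Vec.tabulate (b x))

  adj-matrix : ∀ {n} (b : Fin n → Fin n → Bool) x y → adj (matrix b) x y ≡ b x y
  adj-matrix b x y = trans (cong (λ v → lookup v y) (lookup∘tabulate _ x)) (lookup∘tabulate (b x) y)

  final : ∀ {A : Set} → A → List A → A
  final a [] = a
  final a (b ∷ bs) = final b bs

  final-∈ : ∀ {A : Set} (a : A) as → final a as ∈ a ∷ as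
  final-∈ a [] = here refl
  final-∈ a (b ∷ bs) = there (final-∈ b bs)

  unique-map : ∀ {A B : Set} (h : A → B) {as} →
    (∀ {a b} → a ∈ as → b ∈ as → h a ≡ h b → a ≡ b) → Unique as → Unique (map h as)
  unique-map h inj [] = []
  unique-map h inj (a≢ ∷ u) =
    All.map⁺ (All.tabulate (λ b∈ eq → All.lookup a≢ b∈ (inj (here refl) (there b∈) eq)))
    ∷ unique-map h (λ p q → inj (there p) (there q)) u

  least : ∀ {P : ℕ → Set} k → Decidable P → P k → ∃ λ m → P m × (∀ {j} → P j → m ℕ.≤ j)
  least zero P? p = 0 , p , λ _ → z≤n
  least (suc k) P? p with P? 0
  ... | yes p₀ = 0 , p₀ , λ _ → z≤n
  ... | no ¬p₀ with least k (P? ∘ suc) p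
  ... | m , q , lower =
    suc m , q , λ { {zero} p₀ → contradiction p₀ ¬p₀ ; {suc j} pⱼ → s≤s (lower pⱼ) }

  module _ {n : ℕ} {A : Adj n} where

    reach-trans : ∀ {u v w} → Reach A u v → Reach A v w → Reach A u w
    reach-trans here q = q
    reach-trans (step edge p) q = step edge (reach-trans p q)

    reach-sym : (∀ i j → adj A i j ≡ adj A j i) → ∀ {u v} → Reach A u v → Reach A v u
    reach-sym sm here = here
    reach-sym sm (step {u} {w} edge p) =
      reach-trans (reach-sym sm p) (step (trans (sm w u) edge) here)

    Path : Fin n → Fin n → List (Fin n) → Set
    Path u v ws = Unique (u ∷ ws) × Linked (Edge A) (u ∷ ws) × final u ws ≡ v

    path-suffix : ∀ {u v w} ws → Path w v ws → u ∈ w ∷ ws → ∃ (Path u v)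
    path-suffix ws p (here refl) = ws , p
    path-suffix (w ∷ ws) (_ ∷ uq , _ ∷ ln , fn) (there u∈) = path-suffix ws (uq , ln , fn) u∈

    -- Loop erasure: if the new starting vertex already lies on the path found so far, only the part
    -- from that occurrence on is kept.
    reach-path : ∀ {u v} → Reach A u v → ∃ (Path u v)
    reach-path here = [] , [] ∷ [] , [-] , refl
    reach-path (step {u} {w} edge p) with reach-path p
    ... | ws , q@(uq , ln , fn) with any? (u Fin.≟_) (w ∷ ws)
    ... | yes u∈ = path-suffix ws q u∈
    ... | no u∉ = w ∷ ws , All.¬Any⇒All¬ _ u∉ ∷ uq , edge ∷ ln , fn

  linked-snoc : ∀ {A : Set} {R : A → A → Set} a as {z} →
    Linked R (a ∷ as) → R (final a as) z → Linked R (a ∷ as ++ z ∷ [])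
  linked-snoc a [] _ r = r ∷ [-]
  linked-snoc a (b ∷ bs) (s ∷ l) r = s ∷ linked-snoc b bs l r

  module _ {N : ℕ} where

    -- Unlike `parent`, which maps the root to itself, this relation gives the root no parent, so it
    -- produces no loop there.
    data Up (f : Vec (Fin (suc N)) N) : Fin (suc N) → Fin (suc N) → Set where
      up : ∀ i → Up f (suc i) (lookup f i)

    up? : ∀ f x y → Dec (Up f x y)
    up? f zero y = no λ ()
    up? f (suc i) y = map′ (λ { refl → up i }) (λ { (up _) → refl }) (lookup f i Fin.≟ y)

    up-functional : ∀ {f x y z} → Up f x y → Up f x z → y ≡ z
    up-functional (up i) (up .i) = refl

    up-depth : ∀ {f} → Acyclic f → ∀ {x y} → Up f x y → depth f y ℕ.< depth f x
    up-depth {f} ac (up i) = ℕ.≤-reflexive (sym (depth-parent f ac i))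

    adjacent? : ∀ f x y → Dec (Up f x y ⊎ Up f y x)
    adjacent? f x y = up? f x y ⊎-dec up? f y x

    tree : Vec (Fin (suc N)) N → Adj (suc N)
    tree f = matrix (λ x y → does (adjacent? f x y))

    edge⁻ : ∀ f x y → Edge (tree f) x y → Up f x y ⊎ Up f y x
    edge⁻ f x y p = does⁻ (adjacent? f x y)
      (trans (sym (adj-matrix (λ x y → does (adjacent? f x y)) x y)) p)

    edge⁺ : ∀ f x y → Up f x y ⊎ Up f y x → Edge (tree f) x y
    edge⁺ f x y p = trans (adj-matrix (λ x y → does (adjacent? f x y)) x y)
      (does⁺ (adjacent? f x y) p)

    tree-simple : ∀ f → Acyclic f → IsSimple (tree f)
    tree-simple f ac =
      (λ x y → bool-ext (edge⁺ f y x ∘ Sum.swap ∘ edge⁻ f x y) (edge⁺ f x y ∘ Sum.swap ∘ edge⁻ f y x)) ,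
      λ x → Bool.¬-not λ p → Sum.[ loop {x} , loop {x} ] (edge⁻ f x x p)
      where
      loop : ∀ {x} → ¬ Up f x x
      loop p = ℕ.<-irrefl refl (up-depth ac p)

    tree-connected : ∀ f → Acyclic f → Connected (tree f)
    tree-connected f ac x y = reach-trans (toRoot N x (ac x))
      (reach-sym (proj₁ (tree-simple f ac)) (toRoot N y (ac y)))
      where
      toRoot : ∀ k x → ancestor f k x ≡ zero → Reach (tree f) x zero
      toRoot k zero eq = here
      toRoot (suc k) (suc i) eq = step (edge⁺ f _ _ (inj₁ (up i))) (toRoot k (lookup f i) eq)

    NonBacktracking : List (Fin (suc N)) → Set
    NonBacktracking (x ∷ y ∷ z ∷ l) = x ≢ z × NonBacktracking (y ∷ z ∷ l)
    NonBacktracking _ = ⊤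

    unique⇒nonBacktracking : ∀ {z} l → Unique l → All (_≢ z) l → NonBacktracking (l ++ z ∷ [])
    unique⇒nonBacktracking [] _ _ = tt
    unique⇒nonBacktracking (x ∷ []) _ _ = tt
    unique⇒nonBacktracking (x ∷ y ∷ []) _ (x≢z ∷ _) = x≢z , tt
    unique⇒nonBacktracking (x ∷ y ∷ w ∷ l) ((_ ∷ x≢w ∷ _) ∷ u) (_ ∷ a) =
      x≢w , unique⇒nonBacktracking (y ∷ w ∷ l) u a

    module _ {f : Vec (Fin (suc N)) N} (ac : Acyclic f) where

      -- A non-backtracking walk in a tree climbs for a while and then only descends.
      descending : ∀ {x y z} l → Linked (Edge (tree f)) (x ∷ y ∷ l ++ z ∷ []) →
        NonBacktracking (x ∷ y ∷ l ++ z ∷ []) → Up f y x →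
        depth f x ℕ.< depth f z × Up f z (final y l)
      descending {y = y} {z} [] (_ ∷ yz ∷ _) (x≢z , _) yx with edge⁻ f y z yz
      ... | inj₁ up-yz = contradiction (up-functional yx up-yz) x≢z
      ... | inj₂ up-zy = ℕ.<-trans (up-depth ac yx) (up-depth ac up-zy) , up-zy
      descending {y = y} (w ∷ l) (_ ∷ ln@(yw ∷ _)) (x≢w , nb) yx with edge⁻ f y w yw
      ... | inj₁ up-yw = contradiction (up-functional yx up-yw) x≢w
      ... | inj₂ up-wy with descending l ln nb up-wy
      ... | lt , last = ℕ.<-trans (up-depth ac yx) lt , last

      climbing : ∀ {x y z} l → Linked (Edge (tree f)) (x ∷ y ∷ l ++ z ∷ []) →
        NonBacktracking (x ∷ y ∷ l ++ z ∷ []) → Up f x y →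
        depth f z ℕ.< depth f x ⊎ Up f z (final y l)
      climbing {y = y} {z} [] (_ ∷ yz ∷ _) _ xy with edge⁻ f y z yz
      ... | inj₁ up-yz = inj₁ (ℕ.<-trans (up-depth ac up-yz) (up-depth ac xy))
      ... | inj₂ up-zy = inj₂ up-zy
      climbing {y = y} (w ∷ l) (_ ∷ ln@(yw ∷ _)) (_ , nb) xy with edge⁻ f y w yw
      ... | inj₂ up-wy = inj₂ (proj₂ (descending l ln nb up-wy))
      ... | inj₁ up-yw with climbing l ln nb up-yw
      ... | inj₁ lt = inj₁ (ℕ.<-trans lt (up-depth ac xy))
      ... | inj₂ last = inj₂ last

      -- A cycle that starts by descending ends strictly deeper than it began. One that starts by
      -- climbing from x to y either ends strictly higher or returns to x from the parent of x,
      -- which is y again and would repeat a vertex.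
      tree-acyclic : ¬ HasCycle (tree f)
      tree-acyclic (x , y ∷ z ∷ l , _ , (x≢y ∷ x≢z ∷ x≢l) ∷ u@(y≢ ∷ _) , ln@(xy ∷ _)) =
        Sum.[ climb , (λ yx → ℕ.<-irrefl refl (proj₁ (descending (z ∷ l) ln nb yx))) ] (edge⁻ f x y xy)
        where
        nb : NonBacktracking (x ∷ y ∷ z ∷ l ++ x ∷ [])
        nb = x≢z , unique⇒nonBacktracking (y ∷ z ∷ l) u
          (All.map (λ p q → p (sym q)) (x≢y ∷ x≢z ∷ x≢l))
        climb : ¬ Up f x y
        climb up-xy with climbing (z ∷ l) ln nb up-xy
        ... | inj₁ lt = ℕ.<-irrefl refl lt
        ... | inj₂ last = All.lookup y≢ (final-∈ z l) (up-functional up-xy last)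
      tree-acyclic (_ , _ ∷ [] , s≤s () , _)

    -- Induction on the depth in f, bounded by b. If g oriented the edge the other way, x would be
    -- the parent of y in g, hence by induction also in f; then x and y would be each other's
    -- parents in f.
    up-transfer : ∀ {f g} → Acyclic f → tree f ≡ tree g →
      ∀ b {x y} → depth f x ℕ.< b → Up f x y → Up g x y
    up-transfer {f} {g} ac eq (suc b) {x} {y} (s≤s lt) xy
      with edge⁻ g x y (subst (λ T → Edge T x y) eq (edge⁺ f x y (inj₁ xy)))
    ... | inj₁ up-xy = up-xy
    ... | inj₂ (up j) = contradiction (up-depth ac yx) (ℕ.<-asym (up-depth ac xy))
      where
      yx : Up f y x
      yx = subst (Up f y)
        (up-functional (up-transfer ac eq b (ℕ.<-≤-trans (up-depth ac xy) lt) (up {f} j)) (up {g} j)) (up j)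

    tree-injective : ∀ {f g} → Acyclic f → tree f ≡ tree g → f ≡ g
    tree-injective {f} {g} ac eq = vec-ext λ i →
      up-functional (up-transfer ac eq _ (ℕ.n<1+n _) (up {f} i)) (up {g} i)

    ancestor-settles : ∀ (f : Vec (Fin (suc N)) N) k x → ancestor f k x ≡ zero → ancestor f N x ≡ zero
    ancestor-settles f zero x eq = ancestor-≤ f {0} {N} x z≤n eq
    ancestor-settles f (suc k) x eq = ancestor-stable f x (ancestor-settles f k (parent f x) eq)

    data Walk (T : Adj (suc N)) : ℕ → Fin (suc N) → Set where
      arrived : Walk T 0 zero
      walk : ∀ {k x} → (∃ λ y → Edge T x y × Walk T k y) → Walk T (suc k) x

    walk? : ∀ T k x → Dec (Walk T k x)
    walk? T zero zero = yes arrived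
    walk? T zero (suc i) = no λ ()
    walk? T (suc k) x = map′ walk (λ { (walk w) → w })
      (Fin.any? (λ y → (adj T x y Bool.≟ true) ×-dec walk? T k y))

    reach-walk : ∀ {T x} → Reach T x zero → ∃ λ k → Walk T k x
    reach-walk here = 0 , arrived
    reach-walk (step edge p) with reach-walk p
    ... | k , w = suc k , walk (_ , edge , w)

    module _ (T : Adj (suc N)) (connected : Connected T) where

      -- `towards` is the next vertex on a shortest walk to the root. The strict bound in `minimal`
      -- is the decrease on which `bfs-reaches` runs.
      record Closest (i : Fin N) : Set where
        field
          distance : ℕ
          towards : Fin (suc N)
          edge : Edge T (suc i) towards
          onward : Walk T distance towards
          minimal : ∀ {k} → Walk T k (suc i) → distance ℕ.< k

      closest : ∀ i → Closest i
      closest i with k , w ← reach-walk (connected (suc i) zero)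
        with least k (λ k → walk? T k (suc i)) w
      ... | suc m , walk (y , edge , w′) , lower = record
        { distance = m ; towards = y ; edge = edge ; onward = w′ ; minimal = lower }

      bfs : Vec (Fin (suc N)) N
      bfs = Vec.tabulate (Closest.towards ∘ closest)

      bfs-towards : ∀ i → lookup bfs i ≡ Closest.towards (closest i)
      bfs-towards = lookup∘tabulate _

      bfs-edge : ∀ i → Edge T (suc i) (lookup bfs i)
      bfs-edge i = subst (Edge T (suc i)) (sym (bfs-towards i)) (Closest.edge (closest i))

      bfs-reaches : ∀ b {k} x → Walk T k x → k ℕ.< b → ∃ λ j → ancestor bfs j x ≡ zero
      bfs-reaches b zero _ _ = 0 , refl
      bfs-reaches (suc b) (suc i) w (s≤s lt)
        with bfs-reaches b (Closest.towards (closest i)) (Closest.onward (closest i))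
               (ℕ.<-≤-trans (Closest.minimal (closest i) w) lt)
      ... | j , eq = suc j , trans (cong (ancestor bfs j) (bfs-towards i)) eq

      bfs-acyclic : Acyclic bfs
      bfs-acyclic x with reach-walk (connected x zero)
      ... | k , w with bfs-reaches (suc k) x w ℕ.≤-refl
      ... | j , eq = ancestor-settles bfs j x eq

      -- An edge outside the breadth-first tree closes a cycle with the tree path between its ends.
      tree-bfs : IsSimple T → ¬ HasCycle T → tree bfs ≡ T
      tree-bfs (sm , irr) ¬cycle = adj-ext λ x y → bool-ext tree⊆T (T⊆tree x y)
        where
        tree⊆T : ∀ {x y} → Edge (tree bfs) x y → Edge T x y
        tree⊆T {x} {y} p with edge⁻ bfs x y p
        ... | inj₁ (up i) = bfs-edge i
        ... | inj₂ (up i) = trans (sm (lookup bfs i) (suc i)) (bfs-edge i)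
        T⊆tree : ∀ x y → Edge T x y → Edge (tree bfs) x y
        T⊆tree x y edge with adj (tree bfs) x y Bool.≟ true
        ... | yes p = p
        ... | no ¬p with reach-path (tree-connected bfs bfs-acyclic x y)
        ... | [] , _ , _ , refl = contradiction (trans (sym edge) (irr x)) λ ()
        ... | _ ∷ [] , _ , e ∷ _ , refl = contradiction e ¬p
        ... | v ∷ w ∷ ws , uq , ln , refl = contradiction
          (x , v ∷ w ∷ ws , s≤s (s≤s z≤n) , uq ,
            linked-snoc x (v ∷ w ∷ ws) (Linked.map tree⊆T ln) (trans (sm (final w ws) x) edge))
          ¬cycle

    nbrs : Adj (suc N) → Fin N → List (Fin (suc N))
    nbrs G i = filter (λ y → adj G (suc i) y Bool.≟ true) (allFin (suc N))

    -- `tree` is a bijection from the acyclic choices of neighbours to the spanning trees: injective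
    -- by `tree-injective`, and onto because `tree-bfs` recovers any tree from its own breadth-first
    -- parents.
    spanningTreeCount : ∀ G → IsSimple G → SpanningTreeCount G (treeCount (nbrs G))
    spanningTreeCount G (sm , _) = map tree parentVectors , unique , (λ T → mk⇔ (sound T) (complete T)) ,
      length-map tree parentVectors
      where
      parentVectors : List (Vec (Fin (suc N)) N)
      parentVectors = filter acyclic? (choices (nbrs G))
      acyclic : ∀ {f} → f ∈ parentVectors → Acyclic f
      acyclic f∈ = proj₂ (∈-filter⁻ acyclic? {xs = choices (nbrs G)} f∈)
      unique : Unique (map tree parentVectors)
      unique = unique-map tree (λ f∈ _ → tree-injective (acyclic f∈))
        (Unique.filter⁺ acyclic? (choices-unique (nbrs G)
          (λ i → Unique.filter⁺ (λ y → adj G (suc i) y Bool.≟ true) (Unique.allFin⁺ (suc N)))))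
      sound : ∀ T → IsSpanningTree G T → T ∈ map tree parentVectors
      sound T (simple , T⊆G , conn , ¬cycle) = subst (_∈ map tree parentVectors)
        (tree-bfs T conn simple ¬cycle)
        (∈-map⁺ tree (∈-filter⁺ acyclic? (∈-choices⁺ (nbrs G) (bfs T conn)
          (λ i → ∈-filter⁺ (λ y → adj G (suc i) y Bool.≟ true) (∈-allFin (lookup (bfs T conn) i))
                   (T⊆G _ _ (bfs-edge T conn i)))) (bfs-acyclic T conn)))
      complete : ∀ T → T ∈ map tree parentVectors → IsSpanningTree G T
      complete T T∈ with f , f∈ , refl ← ∈-map⁻ tree T∈ =
        tree-simple f (acyclic f∈) , tree⊆G , tree-connected f (acyclic f∈) , tree-acyclic (acyclic f∈)
        where
        chosen : ∀ i → Edge G (suc i) (lookup f i)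
        chosen i = proj₂ (∈-filter⁻ (λ y → adj G (suc i) y Bool.≟ true) {xs = allFin (suc N)}
          (∈-choices⁻ (nbrs G) f (proj₁ (∈-filter⁻ acyclic? {xs = choices (nbrs G)} f∈)) i))
        tree⊆G : Subgraph (tree f) G
        tree⊆G x y p with edge⁻ f x y p
        ... | inj₁ (up i) = chosen i
        ... | inj₂ (up i) = trans (sm (lookup f i) (suc i)) (chosen i)

    -- Each of the N other vertices has at most N + 1 candidate parents. The bound limits how many
    -- divisors a tree count can have.
    treeCount-≤ : ∀ G → treeCount (nbrs G) ℕ.≤ suc N ℕ.^ N
    treeCount-≤ G = ℕ.≤-trans (length-filter acyclic? (choices (nbrs G)))
      (length-choices (nbrs G) (suc N) λ i → ℕ.≤-trans
        (length-filter (λ y → adj G (suc i) y Bool.≟ true) (allFin (suc N)))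
        (ℕ.≤-reflexive (length-tabulate {n = suc N} id)))

    -- The star at the universal root is a spanning tree. Positivity matters because every number
    -- divides 0.
    treeCount-positive : ∀ G → (∀ i → Edge G (suc i) zero) → 0 ℕ.< treeCount (nbrs G)
    treeCount-positive G universal = nonempty (∈-filter⁺ acyclic?
      (∈-choices⁺ (nbrs G) star λ i →
        subst (_∈ nbrs G i) (sym (lookup∘tabulate _ i)) (∈-filter⁺ (λ y → adj G (suc i) y Bool.≟ true) (∈-allFin zero) (universal i)))
      λ x → ancestor-settles star 1 x (atRoot x))
      where
      star : Vec (Fin (suc N)) N
      star = Vec.tabulate (λ _ → zero)
      atRoot : ∀ x → parent star x ≡ zero
      atRoot zero = refl
      atRoot (suc i) = lookup∘tabulate _ i
      nonempty : ∀ {A : Set} {a : A} {as} → a ∈ as → 0 ℕ.< length as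
      nonempty (here _) = s≤s z≤n
      nonempty (there _) = s≤s z≤n

-- Continuants as factors of tree counts

module DoubledPath where

  open import Defs
  open ExteriorAlgebra
  open ParentVectors
  open SpanningTrees
  open import Data.Bool as Bool using (Bool; true; false)
  open import Data.Nat as ℕ using (ℕ; zero; suc; z≤n; s≤s; _∸_; _<ᵇ_)
  import Data.Nat.Properties as ℕ
  open import Data.Integer using (ℤ; 0ℤ; 1ℤ; -1ℤ; +_; _+_; _*_; -_; _-_)
  import Data.Integer.Properties as ℤ
  open import Data.Integer.Tactic.RingSolver using (solve-∀)
  open import Data.Fin using (Fin; zero; suc; toℕ; splitAt; _↑ˡ_; _↑ʳ_)
  import Data.Fin.Properties as Fin
  open import Data.List using (List; []; _∷_; _++_; filter; tabulate)
  open import Data.List.Membership.Propositional using (_∈_)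
  open import Data.List.Membership.Propositional.Properties using (∈-tabulate⁺; ∈-++⁺ˡ; ∈-++⁺ʳ)
  open import Data.List.Relation.Unary.Any using (here; there)
  open import Data.Vec using (Vec; []; _∷_; lookup)
  open import Data.Product using (_×_; _,_; ∃)
  open import Data.Sum using (_⊎_; inj₁; inj₂; [_,_]′)
  open import Function using (_∘_; id)
  open import Relation.Binary.PropositionalEquality
    using (_≡_; refl; sym; trans; cong; cong₂; module ≡-Reasoning)

  -- The determinant of the tridiagonal matrix with diagonal ds and off-diagonal entries -1.
  continuant : ∀ {m} → Vec ℕ m → ℤ
  continuant [] = 1ℤ
  continuant (d ∷ []) = + d
  continuant (d ∷ d′ ∷ ds) = + d * continuant (d′ ∷ ds) - continuant ds

  private variable
    m n : ℕ

  combine : ℤ → Vect n → ℤ → Vect n → Vect n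
  combine a u b v c = a * u c + b * v c

  ∧-combine : ∀ a (u : Vect n) b v x → combine a u b v ∧ x ≡ a ⊙ u ∧ x ⊕ b ⊙ v ∧ x
  ∧-combine a u b v x = trans (∧-distribʳ (λ c → a * u c) (λ c → b * v c) x)
    (cong₂ _⊕_ (*-∧ a u x) (*-∧ b v x))

  next : ∀ {m} → (Fin m → Vect n) → Vect n
  next {m = zero} f c = 0ℤ
  next {m = suc m} f = f zero

  -- The tridiagonal matrix applied to the family f, with q in the place of the vector before the
  -- first one. The parameter q makes the tail of the matrix an instance of the same definition.
  tridiagonal : Vect n → Vec ℕ m → (Fin m → Vect n) → Fin m → Vect n
  tridiagonal q (d ∷ ds) f zero c = + d * f zero c - next (f ∘ suc) c - q c
  tridiagonal q (d ∷ ds) f (suc i) = tridiagonal (f zero) ds (f ∘ suc) i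

  module _ {n : ℕ} (us : List (Vect n)) where

    ⋀-∧-linear : ∀ a u b v x →
      ⋀ us (combine a u b v ∧ x) ≡ a ⊙ ⋀ us (u ∧ x) ⊕ b ⊙ ⋀ us (v ∧ x)
    ⋀-∧-linear a u b v x = begin
      ⋀ us (combine a u b v ∧ x)                ≡⟨ cong (⋀ us) (∧-combine a u b v x) ⟩
      ⋀ us (a ⊙ u ∧ x ⊕ b ⊙ v ∧ x)              ≡⟨ ⋀-⊕ us _ _ ⟩
      ⋀ us (a ⊙ u ∧ x) ⊕ ⋀ us (b ⊙ v ∧ x)       ≡⟨ cong₂ _⊕_ (⋀-⊙ us a _) (⋀-⊙ us b _) ⟩
      a ⊙ ⋀ us (u ∧ x) ⊕ b ⊙ ⋀ us (v ∧ x)       ∎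
      where open ≡-Reasoning

    ⋀-swap : ∀ u v x → ⋀ us (u ∧ v ∧ x) ≡ -1ℤ ⊙ ⋀ us (v ∧ u ∧ x)
    ⋀-swap u v x = trans (cong (⋀ us) (∧-anticomm u v x)) (⋀-⊙ us -1ℤ _)

  ⋀-row : ∀ (us : List (Vect n)) d u v q x → ⋀ us (q ∧ x) ≡ 0Λ →
    ⋀ us ((λ c → d * u c - v c - q c) ∧ x) ≡ d ⊙ ⋀ us (u ∧ x) ⊕ -1ℤ ⊙ ⋀ us (v ∧ x)
  ⋀-row us d u v q x absorbed = begin
    ⋀ us ((λ c → d * u c - v c - q c) ∧ x)
      ≡⟨ cong (⋀ us) (∧-cong (λ c → solved d (u c) (v c) (q c)) x) ⟩
    ⋀ us (combine 1ℤ (combine d u -1ℤ v) -1ℤ q ∧ x)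
      ≡⟨ ⋀-∧-linear us 1ℤ (combine d u -1ℤ v) -1ℤ q x ⟩
    1ℤ ⊙ ⋀ us (combine d u -1ℤ v ∧ x) ⊕ -1ℤ ⊙ ⋀ us (q ∧ x)
      ≡⟨ cong₂ _⊕_ (⊙-identity _) (cong (-1ℤ ⊙_) absorbed) ⟩
    ⋀ us (combine d u -1ℤ v ∧ x) ⊕ -1ℤ ⊙ 0Λ
      ≡⟨ cong (⋀ us (combine d u -1ℤ v ∧ x) ⊕_) (⊙-zeroʳ -1ℤ) ⟩
    ⋀ us (combine d u -1ℤ v ∧ x) ⊕ 0Λ
      ≡⟨ ⊕-identityʳ _ ⟩
    ⋀ us (combine d u -1ℤ v ∧ x)
      ≡⟨ ⋀-∧-linear us d u -1ℤ v x ⟩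
    d ⊙ ⋀ us (u ∧ x) ⊕ -1ℤ ⊙ ⋀ us (v ∧ x) ∎
    where
    open ≡-Reasoning
    solved : ∀ d a b c → d * a - b - c ≡ 1ℤ * (d * a + -1ℤ * b) + -1ℤ * c
    solved = solve-∀

  ⋀-0 : ∀ (us : List (Vect n)) → ⋀ us 0Λ ≡ 0Λ
  ⋀-0 [] = refl
  ⋀-0 (u ∷ us) = trans (cong (u ∧_) (⋀-0 us)) (∧-zeroʳ u)

  -- The context us holds vectors already moved to the left. It absorbs q, and in the recursion it
  -- also absorbs the vector preceding the remaining rows.
  Tridiagonal : ℕ → Vec ℕ m → Set
  Tridiagonal {m} n ds = ∀ (us : List (Vect n)) q → (∀ y → ⋀ us (q ∧ y) ≡ 0Λ) → ∀ (f : Fin m → Vect n) x →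
    ⋀ us (⋀ (tabulate (tridiagonal q ds f)) x) ≡ continuant ds ⊙ ⋀ us (⋀ (tabulate f) x)

  tridiagonal-[_] : ∀ d → Tridiagonal n (d ∷ [])
  tridiagonal-[_] {n} d us q absorbed f x = begin
    ⋀ us (tridiagonal q (d ∷ []) f zero ∧ x)
      ≡⟨ ⋀-row us (+ d) (f zero) _ q x (absorbed x) ⟩
    + d ⊙ ⋀ us (f zero ∧ x) ⊕ -1ℤ ⊙ ⋀ us (o ∧ x)
      ≡⟨ cong (λ y → + d ⊙ ⋀ us (f zero ∧ x) ⊕ -1ℤ ⊙ ⋀ us y) (∧-zeroˡ o (λ _ → refl) x) ⟩
    + d ⊙ ⋀ us (f zero ∧ x) ⊕ -1ℤ ⊙ ⋀ us 0Λ
      ≡⟨ cong (λ y → + d ⊙ ⋀ us (f zero ∧ x) ⊕ -1ℤ ⊙ y) (⋀-0 us) ⟩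
    + d ⊙ ⋀ us (f zero ∧ x) ⊕ -1ℤ ⊙ 0Λ
      ≡⟨ cong (+ d ⊙ ⋀ us (f zero ∧ x) ⊕_) (⊙-zeroʳ -1ℤ) ⟩
    + d ⊙ ⋀ us (f zero ∧ x) ⊕ 0Λ
      ≡⟨ ⊕-identityʳ _ ⟩
    + d ⊙ ⋀ us (f zero ∧ x) ∎
    where
    open ≡-Reasoning
    o : Vect n
    o c = 0ℤ

  -- The recursion of the continuant by expansion of the first row d f₀ - f₁ - q, where q is
  -- absorbed. The term with f₀ gives the continuant of the tail. In the term with f₁, swapping f₁
  -- with the next row d′ f₁ - f₂ - f₀ leaves only the contribution of f₀, whose sign cancels that
  -- of the swap.
  tridiagonal-∷∷ : ∀ d d′ (ds : Vec ℕ m) →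
    Tridiagonal n (d′ ∷ ds) → Tridiagonal n ds → Tridiagonal n (d ∷ d′ ∷ ds)
  tridiagonal-∷∷ {m} {n} d d′ ds ih₁ ih₂ us q absorbed f x = begin
    ⋀ us (tridiagonal q (d ∷ d′ ∷ ds) f zero ∧ R)
      ≡⟨ ⋀-row us (+ d) f₀ f₁ q R (absorbed R) ⟩
    + d ⊙ ⋀ us (f₀ ∧ R) ⊕ -1ℤ ⊙ ⋀ us (f₁ ∧ R)
      ≡⟨ cong₂ (λ y z → + d ⊙ y ⊕ -1ℤ ⊙ z) fromFirst fromSecond ⟩
    + d ⊙ continuant (d′ ∷ ds) ⊙ X ⊕ -1ℤ ⊙ continuant ds ⊙ X
      ≡⟨ cong₂ _⊕_ (⊙-assoc (+ d) _ X) (⊙-assoc -1ℤ _ X) ⟨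
    (+ d * continuant (d′ ∷ ds)) ⊙ X ⊕ (-1ℤ * continuant ds) ⊙ X
      ≡⟨ ⊙-distribʳ _ _ X ⟨
    (+ d * continuant (d′ ∷ ds) + -1ℤ * continuant ds) ⊙ X
      ≡⟨ cong (λ k → (+ d * continuant (d′ ∷ ds) + k) ⊙ X) (ℤ.-1*i≡-i (continuant ds)) ⟩
    continuant (d ∷ d′ ∷ ds) ⊙ X ∎
    where
    open ≡-Reasoning
    g : Fin m → Vect n
    g i = f (suc (suc i))
    f₀ f₁ f₂ : Vect n
    f₀ = f zero
    f₁ = f (suc zero)
    f₂ = next g
    R R′ X : Λ n
    R = ⋀ (tabulate (tridiagonal f₀ (d′ ∷ ds) (f ∘ suc))) x
    R′ = ⋀ (tabulate (tridiagonal f₁ ds g)) x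
    X = ⋀ us (⋀ (tabulate f) x)

    fromFirst : ⋀ us (f₀ ∧ R) ≡ continuant (d′ ∷ ds) ⊙ X
    fromFirst = begin
      ⋀ us (f₀ ∧ R)
        ≡⟨ ⋀-++ us (f₀ ∷ []) R ⟨
      ⋀ (us ++ f₀ ∷ []) R
        ≡⟨ ih₁ (us ++ f₀ ∷ []) f₀ (⋀-∧-∈ (∈-++⁺ʳ us (here refl))) (f ∘ suc) x ⟩
      continuant (d′ ∷ ds) ⊙ ⋀ (us ++ f₀ ∷ []) (⋀ (tabulate (f ∘ suc)) x)
        ≡⟨ cong (continuant (d′ ∷ ds) ⊙_) (⋀-++ us (f₀ ∷ []) _) ⟩
      continuant (d′ ∷ ds) ⊙ X ∎

    next-∧ : ∀ {k} (g : Fin k → Vect n) us → next g ∈ us → k ≡ 0 ⊎ ⋀ us (⋀ (tabulate g) x) ≡ 0Λ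
    next-∧ {zero} g us _ = inj₁ refl
    next-∧ {suc k} g us g∈ = inj₂ (⋀-∧-∈ g∈ _)

    -- Either the family ends at f₁ and f₂ is 0, or f₂ occurs twice as soon as `ih₂` has turned R′
    -- into a multiple of the wedge of g.
    fromNext : ⋀ us (f₂ ∧ f₁ ∧ R′) ≡ 0Λ
    fromNext with next-∧ g (us ++ f₂ ∷ f₁ ∷ []) (∈-++⁺ʳ us (here refl))
    ... | inj₁ refl = trans (cong (⋀ us) (∧-zeroˡ f₂ (λ _ → refl) _)) (⋀-0 us)
    ... | inj₂ vanishes = begin
      ⋀ us (f₂ ∧ f₁ ∧ R′)
        ≡⟨ ⋀-++ us (f₂ ∷ f₁ ∷ []) R′ ⟨
      ⋀ (us ++ f₂ ∷ f₁ ∷ []) R′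
        ≡⟨ ih₂ (us ++ f₂ ∷ f₁ ∷ []) f₁ (⋀-∧-∈ (∈-++⁺ʳ us (there (here refl)))) g x ⟩
      continuant ds ⊙ ⋀ (us ++ f₂ ∷ f₁ ∷ []) (⋀ (tabulate g) x)
        ≡⟨ cong (continuant ds ⊙_) vanishes ⟩
      continuant ds ⊙ 0Λ
        ≡⟨ ⊙-zeroʳ _ ⟩
      0Λ ∎

    fromSecond : ⋀ us (f₁ ∧ R) ≡ continuant ds ⊙ X
    fromSecond = begin
      ⋀ us (f₁ ∧ R)
        ≡⟨ ⋀-swap us f₁ row R′ ⟩
      -1ℤ ⊙ ⋀ us (row ∧ f₁ ∧ R′)
        ≡⟨ cong (λ y → -1ℤ ⊙ ⋀ us y) (∧-cong (λ c → solved (+ d′) (f₁ c) (f₂ c) (f₀ c)) _) ⟩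
      -1ℤ ⊙ ⋀ us (combine (+ d′) f₁ 1ℤ (combine -1ℤ f₂ -1ℤ f₀) ∧ f₁ ∧ R′)
        ≡⟨ cong (-1ℤ ⊙_) (⋀-∧-linear us (+ d′) f₁ 1ℤ (combine -1ℤ f₂ -1ℤ f₀) (f₁ ∧ R′)) ⟩
      -1ℤ ⊙ (+ d′ ⊙ ⋀ us (f₁ ∧ f₁ ∧ R′) ⊕ 1ℤ ⊙ ⋀ us (combine -1ℤ f₂ -1ℤ f₀ ∧ f₁ ∧ R′))
        ≡⟨ cong (-1ℤ ⊙_) (cong₂ _⊕_ repeated (⊙-identity _)) ⟩
      -1ℤ ⊙ (0Λ ⊕ ⋀ us (combine -1ℤ f₂ -1ℤ f₀ ∧ f₁ ∧ R′))
        ≡⟨ cong (-1ℤ ⊙_) (⊕-identityˡ _) ⟩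
      -1ℤ ⊙ ⋀ us (combine -1ℤ f₂ -1ℤ f₀ ∧ f₁ ∧ R′)
        ≡⟨ cong (-1ℤ ⊙_) (⋀-∧-linear us -1ℤ f₂ -1ℤ f₀ (f₁ ∧ R′)) ⟩
      -1ℤ ⊙ (-1ℤ ⊙ ⋀ us (f₂ ∧ f₁ ∧ R′) ⊕ -1ℤ ⊙ ⋀ us (f₀ ∧ f₁ ∧ R′))
        ≡⟨ cong (λ y → -1ℤ ⊙ (-1ℤ ⊙ y ⊕ -1ℤ ⊙ ⋀ us (f₀ ∧ f₁ ∧ R′))) fromNext ⟩
      -1ℤ ⊙ (-1ℤ ⊙ 0Λ ⊕ -1ℤ ⊙ ⋀ us (f₀ ∧ f₁ ∧ R′))
        ≡⟨ cong (λ y → -1ℤ ⊙ (y ⊕ -1ℤ ⊙ ⋀ us (f₀ ∧ f₁ ∧ R′))) (⊙-zeroʳ -1ℤ) ⟩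
      -1ℤ ⊙ (0Λ ⊕ -1ℤ ⊙ ⋀ us (f₀ ∧ f₁ ∧ R′))
        ≡⟨ cong (-1ℤ ⊙_) (⊕-identityˡ _) ⟩
      -1ℤ ⊙ -1ℤ ⊙ ⋀ us (f₀ ∧ f₁ ∧ R′)
        ≡⟨ ⊙-assoc -1ℤ -1ℤ _ ⟨
      1ℤ ⊙ ⋀ us (f₀ ∧ f₁ ∧ R′)
        ≡⟨ ⊙-identity _ ⟩
      ⋀ us (f₀ ∧ f₁ ∧ R′)
        ≡⟨ ⋀-++ us (f₀ ∷ f₁ ∷ []) R′ ⟨
      ⋀ (us ++ f₀ ∷ f₁ ∷ []) R′
        ≡⟨ ih₂ (us ++ f₀ ∷ f₁ ∷ []) f₁ (⋀-∧-∈ (∈-++⁺ʳ us (there (here refl)))) g x ⟩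
      continuant ds ⊙ ⋀ (us ++ f₀ ∷ f₁ ∷ []) (⋀ (tabulate g) x)
        ≡⟨ cong (continuant ds ⊙_) (⋀-++ us (f₀ ∷ f₁ ∷ []) _) ⟩
      continuant ds ⊙ X ∎
      where
      row : Vect n
      row = tridiagonal f₀ (d′ ∷ ds) (f ∘ suc) zero
      solved : ∀ d a b c → d * a - b - c ≡ d * a + 1ℤ * (-1ℤ * b + -1ℤ * c)
      solved = solve-∀
      repeated : + d′ ⊙ ⋀ us (f₁ ∧ f₁ ∧ R′) ≡ 0Λ
      repeated = trans (cong (λ y → + d′ ⊙ ⋀ us y) (∧-alternating f₁ R′))
        (trans (cong (+ d′ ⊙_) (⋀-0 us)) (⊙-zeroʳ (+ d′)))

  ⋀-tridiagonal : ∀ (ds : Vec ℕ m) → Tridiagonal n ds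
  ⋀-tridiagonal [] us q absorbed f x = sym (⊙-identity _)
  ⋀-tridiagonal (d ∷ []) = tridiagonal-[ d ]
  ⋀-tridiagonal (d ∷ d′ ∷ ds) =
    tridiagonal-∷∷ d d′ ds (⋀-tridiagonal (d′ ∷ ds)) (⋀-tridiagonal ds)

  -- Laplacian rows of the doubled path as finite sums

  bit : Bool → ℤ
  bit true = 1ℤ
  bit false = 0ℤ

  ∑ᶠ : (Fin n → ℤ) → ℤ
  ∑ᶠ {zero} g = 0ℤ
  ∑ᶠ {suc n} g = g zero + ∑ᶠ (g ∘ suc)

  ∑ᶠ-cong : {g h : Fin n → ℤ} → (∀ i → g i ≡ h i) → ∑ᶠ g ≡ ∑ᶠ h
  ∑ᶠ-cong {zero} eq = refl
  ∑ᶠ-cong {suc n} eq = cong₂ _+_ (eq zero) (∑ᶠ-cong (eq ∘ suc))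

  ∑ᶠ-zero : (g : Fin n → ℤ) → (∀ i → g i ≡ 0ℤ) → ∑ᶠ g ≡ 0ℤ
  ∑ᶠ-zero {zero} g eq = refl
  ∑ᶠ-zero {suc n} g eq = cong₂ _+_ (eq zero) (∑ᶠ-zero (g ∘ suc) (eq ∘ suc))

  ∑ᶠ-split : ∀ m {k} (g : Fin (m ℕ.+ k) → ℤ) → ∑ᶠ g ≡ ∑ᶠ (λ i → g (i ↑ˡ k)) + ∑ᶠ (λ j → g (m ↑ʳ j))
  ∑ᶠ-split zero g = sym (ℤ.+-identityˡ _)
  ∑ᶠ-split (suc m) {k} g = trans (cong (λ s → g zero + s) (∑ᶠ-split m (g ∘ suc)))
    (sym (ℤ.+-assoc (g zero) (∑ᶠ (λ i → g (suc (i ↑ˡ k)))) _))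

  ∑-filter : ∀ {A : Set} (b : A → Bool) (h : Fin n → A) g →
    ∑ (filter (λ a → b a Bool.≟ true) (tabulate h)) g ≡ ∑ᶠ (λ i → bit (b (h i)) * g (h i))
  ∑-filter {zero} b h g = refl
  ∑-filter {suc n} b h g with b (h zero)
  ... | true = cong₂ _+_ (sym (ℤ.*-identityˡ (g (h zero)))) (∑-filter b (h ∘ suc) g)
  ... | false = trans (∑-filter b (h ∘ suc) g)
    (sym (trans (cong (λ s → s + ∑ᶠ (λ i → bit (b (h (suc i))) * g (h (suc i)))) (ℤ.*-zeroˡ (g (h zero))))
                (ℤ.+-identityˡ _)))

  tabulate-split : ∀ {A : Set} m {k} (g : Fin (m ℕ.+ k) → A) →
    tabulate g ≡ tabulate (λ i → g (i ↑ˡ k)) ++ tabulate (λ j → g (m ↑ʳ j))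
  tabulate-split zero g = refl
  tabulate-split (suc m) g = cong (g zero ∷_) (tabulate-split m (g ∘ suc))

  isFirst : Fin m → Bool
  isFirst zero = true
  isFirst (suc _) = false

  pathAdj : Fin m → Fin m → Bool
  pathAdj zero zero = false
  pathAdj zero (suc j) = isFirst j
  pathAdj (suc i) zero = isFirst i
  pathAdj (suc i) (suc j) = pathAdj i j

  pathAdj-sym : ∀ (i j : Fin m) → pathAdj i j ≡ pathAdj j i
  pathAdj-sym zero zero = refl
  pathAdj-sym zero (suc j) = refl
  pathAdj-sym (suc i) zero = refl
  pathAdj-sym (suc i) (suc j) = pathAdj-sym i j

  pathAdj-irrefl : ∀ (i : Fin m) → pathAdj i i ≡ false
  pathAdj-irrefl zero = refl
  pathAdj-irrefl (suc i) = pathAdj-irrefl i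

  firstℕ : Fin m → ℕ
  firstℕ zero = 1
  firstℕ (suc _) = 0

  pathDegree : Fin m → ℕ
  pathDegree {suc zero} zero = 0
  pathDegree {suc (suc m)} zero = 1
  pathDegree (suc i) = firstℕ i ℕ.+ pathDegree i

  -- The left-hand side is the degree of i once a vertex is prepended to the path, which is the form
  -- that the induction reproduces.
  firstℕ+pathDegree≤2 : ∀ (i : Fin m) → firstℕ i ℕ.+ pathDegree i ℕ.≤ 2
  firstℕ+pathDegree≤2 {suc zero} zero = s≤s z≤n
  firstℕ+pathDegree≤2 {suc (suc m)} zero = s≤s (s≤s z≤n)
  firstℕ+pathDegree≤2 (suc i) = firstℕ+pathDegree≤2 i

  pathDegree≤2 : ∀ (i : Fin m) → pathDegree i ℕ.≤ 2
  pathDegree≤2 i = ℕ.≤-trans (ℕ.m≤n+m (pathDegree i) (firstℕ i)) (firstℕ+pathDegree≤2 i)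

  ∑-isFirst : ∀ (f : Fin m → Vect n) c → ∑ᶠ (λ j → bit (isFirst j) * f j c) ≡ next f c
  ∑-isFirst {zero} f c = refl
  ∑-isFirst {suc m} f c = trans
    (cong₂ _+_ (ℤ.*-identityˡ (f zero c)) (∑ᶠ-zero _ (λ i → ℤ.*-zeroˡ (f (suc i) c))))
    (ℤ.+-identityʳ (f zero c))

  ∑-pathAdj : ∀ (i : Fin m) → ∑ᶠ (λ j → bit (pathAdj i j)) ≡ + pathDegree i
  ∑-pathAdj {suc zero} zero = refl
  ∑-pathAdj {suc (suc m)} zero = cong (λ s → 0ℤ + (1ℤ + s)) (∑ᶠ-zero {m} (λ _ → 0ℤ) (λ _ → refl))
  ∑-pathAdj {suc (suc m)} (suc zero) = cong (λ s → 1ℤ + s) (∑-pathAdj {suc m} zero)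
  ∑-pathAdj (suc (suc i)) = cong (λ s → 0ℤ + s) (∑-pathAdj (suc i))

  ∑-< : ∀ {h} w → w ℕ.≤ h → ∑ᶠ {h} (λ k → bit (toℕ k <ᵇ w)) ≡ + w
  ∑-< {h} zero _ = ∑ᶠ-zero {h} (λ _ → 0ℤ) (λ _ → refl)
  ∑-< (suc w) (s≤s w≤h) = cong (λ s → 1ℤ + s) (∑-< w w≤h)

  tridiagonal-entry : ∀ q (ds : Vec ℕ m) (f : Fin m → Vect n) i c → tridiagonal q ds f i c ≡
    + lookup ds i * f i c - ∑ᶠ (λ j → bit (pathAdj i j) * f j c) - bit (isFirst i) * q c
  tridiagonal-entry q (d ∷ ds) f zero c = begin
    + d * f zero c - next (f ∘ suc) c - q c
      ≡⟨ solved (+ d) (f zero c) _ (q c) ⟩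
    + d * f zero c - (0ℤ * f zero c + next (f ∘ suc) c) - 1ℤ * q c
      ≡⟨ cong (λ s → + d * f zero c - (0ℤ * f zero c + s) - 1ℤ * q c) (∑-isFirst (f ∘ suc) c) ⟨
    + d * f zero c - (0ℤ * f zero c + ∑ᶠ (λ j → bit (isFirst j) * f (suc j) c)) - 1ℤ * q c ∎
    where
    open ≡-Reasoning
    solved : ∀ d a b q → d * a - b - q ≡ d * a - (0ℤ * a + b) - 1ℤ * q
    solved = solve-∀
  tridiagonal-entry q (d ∷ ds) f (suc i) c = trans (tridiagonal-entry (f zero) ds (f ∘ suc) i c)
    (solved (+ lookup ds i * f (suc i) c) (∑ᶠ (λ j → bit (pathAdj i j) * f (suc j) c))
            (bit (isFirst i)) (f zero c) (q c))
    where
    solved : ∀ a s b z q → a - s - b * z ≡ a - (b * z + s) - 0ℤ * q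
    solved = solve-∀

  -- The left and right copies of the path see the same hub vertices, so that f i = e (right i) - e (left i)
  -- spans an invariant subspace of the Laplacian, on which it is tridiagonal.
  data Vertex (m h : ℕ) : Set where
    root : Vertex m h
    left right : Fin m → Vertex m h
    hub : Fin h → Vertex m h

  module PathGraph {m h : ℕ} (w : Fin m → ℕ) where

    N : ℕ
    N = m ℕ.+ (m ℕ.+ h)

    joined : Vertex m h → Vertex m h → Bool
    joined root root = false
    joined root _ = true
    joined _ root = true
    joined (left i) (left j) = pathAdj i j
    joined (right i) (right j) = pathAdj i j
    joined (left i) (hub k) = toℕ k <ᵇ w i
    joined (right i) (hub k) = toℕ k <ᵇ w i
    joined (hub k) (left i) = toℕ k <ᵇ w i
    joined (hub k) (right i) = toℕ k <ᵇ w i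
    joined (left _) (right _) = false
    joined (right _) (left _) = false
    joined (hub _) (hub _) = false

    joined-sym : ∀ x y → joined x y ≡ joined y x
    joined-sym root root = refl
    joined-sym root (left _) = refl
    joined-sym root (right _) = refl
    joined-sym root (hub _) = refl
    joined-sym (left _) root = refl
    joined-sym (right _) root = refl
    joined-sym (hub _) root = refl
    joined-sym (left i) (left j) = pathAdj-sym i j
    joined-sym (right i) (right j) = pathAdj-sym i j
    joined-sym (left _) (hub _) = refl
    joined-sym (right _) (hub _) = refl
    joined-sym (hub _) (left _) = refl
    joined-sym (hub _) (right _) = refl
    joined-sym (left _) (right _) = refl
    joined-sym (right _) (left _) = refl
    joined-sym (hub _) (hub _) = refl

    joined-irrefl : ∀ x → joined x x ≡ false
    joined-irrefl root = refl
    joined-irrefl (left i) = pathAdj-irrefl i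
    joined-irrefl (right i) = pathAdj-irrefl i
    joined-irrefl (hub _) = refl

    L R : Fin m → Fin N
    L i = i ↑ˡ (m ℕ.+ h)
    R i = m ↑ʳ (i ↑ˡ h)

    H : Fin h → Fin N
    H k = m ↑ʳ (m ↑ʳ k)

    decode : Fin (suc N) → Vertex m h
    decode zero = root
    decode (suc k) = [ left , (λ j → [ right , hub ]′ (splitAt m j)) ]′ (splitAt m k)

    decode-L : ∀ i → decode (suc (L i)) ≡ left i
    decode-L i rewrite Fin.splitAt-↑ˡ m i (m ℕ.+ h) = refl

    decode-R : ∀ i → decode (suc (R i)) ≡ right i
    decode-R i rewrite Fin.splitAt-↑ʳ m (m ℕ.+ h) (i ↑ˡ h) | Fin.splitAt-↑ˡ m i h = refl

    decode-H : ∀ k → decode (suc (H k)) ≡ hub k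
    decode-H k rewrite Fin.splitAt-↑ʳ m (m ℕ.+ h) (m ↑ʳ k) | Fin.splitAt-↑ʳ m h k = refl

    joined′ : Fin (suc N) → Fin (suc N) → Bool
    joined′ x y = joined (decode x) (decode y)

    G : Adj (suc N)
    G = matrix joined′

    G-simple : IsSimple G
    G-simple =
      (λ x y → trans (adj-matrix joined′ x y)
        (trans (joined-sym (decode x) (decode y)) (sym (adj-matrix joined′ y x)))) ,
      λ x → trans (adj-matrix joined′ x x) (joined-irrefl (decode x))

    G-universal : ∀ i → Edge G (suc i) zero
    G-universal i = trans (adj-matrix joined′ (suc i) zero) (toRoot (splitAt m i))
      where
      toRoot : ∀ s → joined ([ left , (λ j → [ right , hub ]′ (splitAt m j)) ]′ s) root ≡ true
      toRoot (inj₁ _) = refl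
      toRoot (inj₂ j) with splitAt m j
      ... | inj₁ _ = refl
      ... | inj₂ _ = refl

    row : Fin N → Vect N
    row k c = ∑ (nbrs G k) (λ y → link k y c)

    toLeft toRight toHub : Fin N → Vertex m h → Fin N → ℤ
    toLeft k x c = ∑ᶠ (λ j → bit (joined x (left j)) * (e k c - e (L j) c))
    toRight k x c = ∑ᶠ (λ j → bit (joined x (right j)) * (e k c - e (R j) c))
    toHub k x c = ∑ᶠ (λ j → bit (joined x (hub j)) * (e k c - e (H j) c))

    -- The leading e k is the edge to the root: its column is deleted, so nothing is subtracted.
    row-sum : ∀ k c → row k c ≡
      e k c + (toLeft k (decode (suc k)) c + (toRight k (decode (suc k)) c + toHub k (decode (suc k)) c))
    row-sum k c = begin
      row k c
        ≡⟨ ∑-filter (adj G (suc k)) id (λ y → link k y c) ⟩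
      ∑ᶠ (λ y → bit (adj G (suc k) y) * link k y c)
        ≡⟨ cong₂ _+_ atRoot (trans (∑ᶠ-split m term)
             (cong (λ s → ∑ᶠ (λ j → term (L j)) + s) (∑ᶠ-split m (λ j → term (m ↑ʳ j))))) ⟩
      e k c + (∑ᶠ (λ j → term (L j)) + (∑ᶠ (λ j → term (R j)) + ∑ᶠ (λ j → term (H j))))
        ≡⟨ cong (λ s → e k c + s) (cong₂ _+_ (∑ᶠ-cong (λ j → at (L j) (decode-L j)))
             (cong₂ _+_ (∑ᶠ-cong (λ j → at (R j) (decode-R j))) (∑ᶠ-cong (λ j → at (H j) (decode-H j))))) ⟩
      e k c + (toLeft k x c + (toRight k x c + toHub k x c)) ∎
      where
      open ≡-Reasoning
      x = decode (suc k)
      term : Fin N → ℤ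
      term y = bit (adj G (suc k) (suc y)) * (e k c - e y c)
      atRoot : bit (adj G (suc k) zero) * (e k c - 0ℤ) ≡ e k c
      atRoot = trans (cong (λ b → bit b * (e k c - 0ℤ)) (G-universal k))
        (trans (ℤ.*-identityˡ _) (ℤ.+-identityʳ (e k c)))
      at : ∀ y {v} → decode (suc y) ≡ v → term y ≡ bit (joined x v) * (e k c - e y c)
      at y eq = cong (λ b → bit b * (e k c - e y c))
        (trans (adj-matrix joined′ (suc k) (suc y)) (cong (joined x) eq))

    f : Fin m → Vect N
    f i c = e (R i) c - e (L i) c

    -- Compares two Laplacian rows with equal adjacencies b in one block: the change of base vertex
    -- is weighted by the degree, and the change of the neighbours enters as a sum of differences.
    ∑-difference : ∀ {k} (b : Fin k → ℤ) (u v : Fin k → ℤ) x y →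
      ∑ᶠ (λ j → b j * (x - u j)) ≡
      ∑ᶠ (λ j → b j * (y - v j)) + (∑ᶠ b * (x - y) - ∑ᶠ (λ j → b j * (u j - v j)))
    ∑-difference {zero} b u v x y = solved x y
      where
      solved : ∀ x y → 0ℤ ≡ 0ℤ + (0ℤ * (x - y) - 0ℤ)
      solved = solve-∀
    ∑-difference {suc k} b u v x y =
      trans (cong (λ s → b zero * (x - u zero) + s) (∑-difference (b ∘ suc) (u ∘ suc) (v ∘ suc) x y))
        (solved (b zero) (u zero) (v zero) x y _ _ _)
      where
      solved : ∀ b u v x y s t r → b * (x - u) + (s + (t * (x - y) - r)) ≡
        b * (y - v) + s + ((b + t) * (x - y) - (b * (u - v) + r))
      solved = solve-∀

    module _ (ds : Vec ℕ m) (w≤h : ∀ i → w i ℕ.≤ h)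
             (diagonal : ∀ i → lookup ds i ≡ suc (pathDegree i ℕ.+ w i)) where

      o : Vect N
      o c = 0ℤ

      -- In the difference of the two rows the common hub targets cancel. What remains is f i times
      -- the full degree, made up of the root, the path neighbours and w i hubs, minus f at the path
      -- neighbours.
      row-R : ∀ i c → row (R i) c ≡ row (L i) c + tridiagonal o ds f i c
      row-R i c = begin
        row (R i) c
          ≡⟨ row-sum (R i) c ⟩
        r + (toLeft (R i) (decode (suc (R i))) c + (toRight (R i) (decode (suc (R i))) c + toHub (R i) (decode (suc (R i))) c))
          ≡⟨ cong (λ x → r + (toLeft (R i) x c + (toRight (R i) x c + toHub (R i) x c))) (decode-R i) ⟩
        r + (toLeft (R i) (right i) c + (toRight (R i) (right i) c + toHub (R i) (right i) c))
          ≡⟨ cong (λ s → r + s) (cong₂ _+_ (∑ᶠ-zero _ (λ j → ℤ.*-zeroˡ (r - e (L j) c)))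
               (cong₂ _+_ pathPart hubPart)) ⟩
        r + (0ℤ + ((P + (+ pathDegree i * (r - l) - S)) + (Q + (+ w i * (r - l) - 0ℤ))))
          ≡⟨ solved r l P Q S (+ pathDegree i) (+ w i) 0ℤ ⟩
        l + (P + (0ℤ + Q)) + ((1ℤ + (+ pathDegree i + + w i)) * (r - l) - S - 0ℤ * 0ℤ)
          ≡⟨ cong (λ d → l + (P + (0ℤ + Q)) + (d * (r - l) - S - 0ℤ)) (cong +_ (diagonal i)) ⟨
        l + (P + (0ℤ + Q)) + (+ lookup ds i * (r - l) - S - 0ℤ)
          ≡⟨ cong₂ (λ z b → l + (P + (z + Q)) + (+ lookup ds i * (r - l) - S - b))
               (∑ᶠ-zero _ (λ j → ℤ.*-zeroˡ (l - e (R j) c))) (ℤ.*-zeroʳ (bit (isFirst i))) ⟨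
        l + (P + (toRight (L i) (left i) c + Q)) + (+ lookup ds i * (r - l) - S - bit (isFirst i) * 0ℤ)
          ≡⟨ cong₂ _+_ (cong (λ x → l + (toLeft (L i) x c + (toRight (L i) x c + toHub (L i) x c))) (decode-L i))
               (tridiagonal-entry o ds f i c) ⟨
        l + (toLeft (L i) (decode (suc (L i))) c + (toRight (L i) (decode (suc (L i))) c + toHub (L i) (decode (suc (L i))) c))
          + tridiagonal o ds f i c
          ≡⟨ cong (λ s → s + tridiagonal o ds f i c) (row-sum (L i) c) ⟨
        row (L i) c + tridiagonal o ds f i c ∎
        where
        open ≡-Reasoning
        r = e (R i) c
        l = e (L i) c
        P = toLeft (L i) (left i) c
        Q = toHub (L i) (left i) c
        S = ∑ᶠ (λ j → bit (pathAdj i j) * f j c)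
        pathPart : toRight (R i) (right i) c ≡ P + (+ pathDegree i * (r - l) - S)
        pathPart = trans (∑-difference (λ j → bit (pathAdj i j)) (λ j → e (R j) c) (λ j → e (L j) c) r l)
          (cong (λ d → P + (d * (r - l) - S)) (∑-pathAdj i))
        hubPart : toHub (R i) (right i) c ≡ Q + (+ w i * (r - l) - 0ℤ)
        hubPart = trans (∑-difference (λ j → bit (toℕ j <ᵇ w i)) (λ j → e (H j) c) (λ j → e (H j) c) r l)
          (cong₂ (λ d z → Q + (d * (r - l) - z)) (∑-< (w i) (w≤h i))
            (∑ᶠ-zero _ (λ j → trans (cong (λ z → bit (toℕ j <ᵇ w i) * z) (ℤ.+-inverseʳ (e (H j) c)))
                                    (ℤ.*-zeroʳ (bit (toℕ j <ᵇ w i))))))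
        solved : ∀ r l P Q S p w z → r + (0ℤ + ((P + (p * (r - l) - S)) + (Q + (w * (r - l) - 0ℤ)))) ≡
          l + (P + (0ℤ + Q)) + ((1ℤ + (p + w)) * (r - l) - S - 0ℤ * 0ℤ)
        solved = solve-∀

      -- Row operations replace the right rows by the tridiagonal image of f, and `⋀-tridiagonal`
      -- extracts the continuant. The cofactor is the determinant with the plain vectors f in their
      -- place.
      continuant∣treeCount : ∃ λ k → + treeCount (nbrs G) ≡ continuant ds * k
      continuant∣treeCount = top Y , (begin
        + treeCount (nbrs G)
          ≡⟨ top-laplacian (nbrs G) ⟨
        top (⋀ (tabulate row) 1Λ)
          ≡⟨ cong top blocks ⟩
        top (⋀ lefts (⋀ (tabulate (row ∘ R)) Z))
          ≡⟨ cong top (absorb lefts (row ∘ L) (row ∘ R) (tridiagonal o ds f) (∈-tabulate⁺ {f = row ∘ L}) row-R Z) ⟩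
        top (⋀ lefts (⋀ (tabulate (tridiagonal o ds f)) Z))
          ≡⟨ cong top (⋀-tridiagonal ds lefts o
               (λ y → trans (cong (⋀ lefts) (∧-zeroˡ o (λ _ → refl) y)) (⋀-0 lefts)) f Z) ⟩
        top (continuant ds ⊙ Y)
          ≡⟨ top-⊙ (continuant ds) Y ⟩
        continuant ds * top Y ∎)
        where
        open ≡-Reasoning
        lefts : List (Vect N)
        lefts = tabulate (row ∘ L)
        Y Z : Λ N
        Z = ⋀ (tabulate (row ∘ H)) 1Λ
        Y = ⋀ lefts (⋀ (tabulate f) Z)
        blocks : ⋀ (tabulate row) 1Λ ≡ ⋀ lefts (⋀ (tabulate (row ∘ R)) Z)
        blocks = begin
          ⋀ (tabulate row) 1Λ
            ≡⟨ cong (λ vs → ⋀ vs 1Λ) (tabulate-split m row) ⟩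
          ⋀ (lefts ++ tabulate (λ j → row (m ↑ʳ j))) 1Λ
            ≡⟨ ⋀-++ lefts _ 1Λ ⟩
          ⋀ lefts (⋀ (tabulate (λ j → row (m ↑ʳ j))) 1Λ)
            ≡⟨ cong (λ vs → ⋀ lefts (⋀ vs 1Λ)) (tabulate-split m _) ⟩
          ⋀ lefts (⋀ (tabulate (row ∘ R) ++ tabulate (row ∘ H)) 1Λ)
            ≡⟨ cong (⋀ lefts) (⋀-++ (tabulate (row ∘ R)) _ 1Λ) ⟩
          ⋀ lefts (⋀ (tabulate (row ∘ R)) Z) ∎
        -- Since u zero already stands in us, it drops out of v zero; what is left, g zero, joins
        -- the context before the next row is treated.
        absorb : ∀ {k} us (u v g : Fin k → Vect N) → (∀ i → u i ∈ us) →
          (∀ i c → v i c ≡ u i c + g i c) → ∀ x →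
          ⋀ us (⋀ (tabulate v) x) ≡ ⋀ us (⋀ (tabulate g) x)
        absorb {zero} us u v g u∈ eq x = refl
        absorb {suc k} us u v g u∈ eq x = begin
          ⋀ us (v zero ∧ ⋀ (tabulate (v ∘ suc)) x)
            ≡⟨ cong (⋀ us) (∧-cong (eq zero) _) ⟩
          ⋀ us ((λ c → u zero c + g zero c) ∧ ⋀ (tabulate (v ∘ suc)) x)
            ≡⟨ cong (⋀ us) (∧-distribʳ (u zero) (g zero) _) ⟩
          ⋀ us (u zero ∧ ⋀ (tabulate (v ∘ suc)) x ⊕ g zero ∧ ⋀ (tabulate (v ∘ suc)) x)
            ≡⟨ ⋀-⊕ us _ _ ⟩
          ⋀ us (u zero ∧ ⋀ (tabulate (v ∘ suc)) x) ⊕ ⋀ us (g zero ∧ ⋀ (tabulate (v ∘ suc)) x)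
            ≡⟨ cong (_⊕ ⋀ us (g zero ∧ ⋀ (tabulate (v ∘ suc)) x)) (⋀-∧-∈ (u∈ zero) _) ⟩
          0Λ ⊕ ⋀ us (g zero ∧ ⋀ (tabulate (v ∘ suc)) x)
            ≡⟨ ⊕-identityˡ _ ⟩
          ⋀ us (g zero ∧ ⋀ (tabulate (v ∘ suc)) x)
            ≡⟨ ⋀-++ us (g zero ∷ []) _ ⟨
          ⋀ (us ++ g zero ∷ []) (⋀ (tabulate (v ∘ suc)) x)
            ≡⟨ absorb (us ++ g zero ∷ []) (u ∘ suc) (v ∘ suc) (g ∘ suc) (∈-++⁺ˡ ∘ u∈ ∘ suc) (eq ∘ suc) x ⟩
          ⋀ (us ++ g zero ∷ []) (⋀ (tabulate (g ∘ suc)) x)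
            ≡⟨ ⋀-++ us (g zero ∷ []) _ ⟩
          ⋀ us (g zero ∧ ⋀ (tabulate (g ∘ suc)) x) ∎

  -- An entry counts 1 for the root, at most 2 path neighbours and the hubs. From 3 upwards the
  -- number of hubs is nonnegative, and up to h + 1 it does not exceed h.
  attained : ∀ h (ds : Vec ℕ m) → (∀ i → 3 ℕ.≤ lookup ds i) → (∀ i → lookup ds i ℕ.≤ suc h) →
    ∃ λ t → InT (suc (m ℕ.+ (m ℕ.+ h))) t × 0 ℕ.< t ×
      t ℕ.≤ suc (m ℕ.+ (m ℕ.+ h)) ℕ.^ (m ℕ.+ (m ℕ.+ h)) × ∃ λ k → + t ≡ continuant ds * k
  attained {m} h ds lower upper =
    treeCount (nbrs G) , (G , G-simple , spanningTreeCount G G-simple) ,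
    treeCount-positive G G-universal , treeCount-≤ G , continuant∣treeCount ds w≤h diagonal
    where
    w : Fin m → ℕ
    w i = lookup ds i ∸ suc (pathDegree i)
    open PathGraph {m} {h} w
    w≤h : ∀ i → w i ℕ.≤ h
    w≤h i = ℕ.m≤n+o⇒m∸n≤o (lookup ds i) (suc (pathDegree i))
      (ℕ.≤-trans (upper i) (s≤s (ℕ.m≤n+m h (pathDegree i))))
    diagonal : ∀ i → lookup ds i ≡ suc (pathDegree i ℕ.+ w i)
    diagonal i = sym (ℕ.m+[n∸m]≡n (ℕ.≤-trans (s≤s (pathDegree≤2 i)) (lower i)))

-- Counting continuants by Euclid's algorithm

module Counting where

  open ParentVectors using (choices; choices-unique; ∈-choices⁺; ∈-choices⁻; length-cartesianProductWith)
  open SpanningTrees using (unique-map)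
  open DoubledPath using (continuant)
  open import Data.Nat using (ℕ; zero; suc; z≤n; s≤s; _+_; _*_; _∸_; _^_; _≤_; _<_; _⊔_; NonZero; >-nonZero; nonTrivial⇒n>1)
  open import Data.Nat.Properties
  open import Data.Nat.Divisibility using (_∣_; _∣?_; divides; *-cancelˡ-∣; ∣1⇒≡1)
  open import Data.Nat.Coprimality using (Coprime; coprime-divisor)
  open import Data.Nat.Primality using (Prime; prime⇒irreducible; prime⇒nonZero; prime⇒nonTrivial)
  open import Data.Nat.Primality.Factorisation using (PrimeFactorisation; factorise)
  open import Data.Nat.ListAction using (product)
  open import Data.Nat.Tactic.RingSolver using (solve-∀)
  import Data.Integer as ℤ
  import Data.Integer.Properties as ℤ
  open import Data.Fin using (Fin; zero; suc)
  open import Data.List using (List; []; _∷_; _++_; map; length; deduplicate; applyUpTo; cartesianProduct)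
  open import Data.List.Properties using (length-map; length-++; length-applyUpTo)
  open import Data.List.Membership.Propositional using (_∈_)
  open import Data.List.Membership.Propositional.Properties
    using (∈-∃++; ∈-++⁺ˡ; ∈-++⁺ʳ; ∈-++⁻; ∈-map⁺; ∈-map⁻; ∈-deduplicate⁺; ∈-cartesianProduct⁺; ∈-applyUpTo⁻)
  open import Data.List.Relation.Unary.Any using (here; there)
  open import Data.List.Relation.Unary.All as All using (All; []; _∷_)
  open import Data.List.Relation.Unary.AllPairs using ([]; _∷_)
  open import Data.List.Relation.Unary.Unique.Propositional using (Unique)
  import Data.List.Relation.Unary.Unique.Propositional.Properties as Unique
  open import Data.Vec as Vec using (Vec; []; _∷_; lookup)
  open import Data.Product using (_×_; _,_; ∃; proj₁; proj₂)
  open import Data.Sum using (_⊎_; inj₁; inj₂)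
  open import Function using (_∘_)
  open import Relation.Binary.PropositionalEquality
    using (_≡_; refl; sym; trans; cong; cong₂; subst; subst₂; module ≡-Reasoning)
  open import Relation.Nullary using (¬_; yes; no; contradiction)

  private variable
    m n : ℕ

  -- The subtraction never truncates when all entries are at least 2.
  continuantℕ : Vec ℕ m → ℕ
  continuantℕ [] = 1
  continuantℕ (d ∷ []) = d
  continuantℕ (d ∷ d′ ∷ ds) = d * continuantℕ (d′ ∷ ds) ∸ continuantℕ ds

  Large : Vec ℕ m → Set
  Large ds = ∀ i → 2 ≤ lookup ds i

  -- If B < A and d is at least 2, then d A - B is at least A + (A - B), so prepending an entry
  -- increases the continuant strictly.
  continuantℕ-< : ∀ d (ds : Vec ℕ m) → Large (d ∷ ds) →
    0 < continuantℕ ds × continuantℕ ds < continuantℕ (d ∷ ds)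
  continuantℕ-< d [] large = s≤s z≤n , large zero
  continuantℕ-< d (d′ ∷ ds) large with continuantℕ-< d′ ds (large ∘ suc)
  ... | pos , lt = <-trans pos lt , (begin-strict
      A                    <⟨ m+n≤o⇒m≤o∸n (suc A) (begin
        suc (A + B)          ≡⟨ +-suc A B ⟨
        A + suc B            ≤⟨ +-monoʳ-≤ A lt ⟩
        A + A                ≡⟨ cong (A +_) (+-identityʳ A) ⟨
        2 * A                ≤⟨ *-monoˡ-≤ A (large zero) ⟩
        d * A                ∎) ⟩
      d * A ∸ B            ∎)
    where
    open ≤-Reasoning
    A = continuantℕ (d′ ∷ ds)
    B = continuantℕ ds

  continuantℕ-step : ∀ d d′ (ds : Vec ℕ m) → Large (d ∷ d′ ∷ ds) →
    continuantℕ (d ∷ d′ ∷ ds) + continuantℕ ds ≡ d * continuantℕ (d′ ∷ ds)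
  continuantℕ-step d d′ ds large = m∸n+n≡m (begin
    continuantℕ ds                ≤⟨ <⇒≤ (proj₂ (continuantℕ-< d′ ds (large ∘ suc))) ⟩
    continuantℕ (d′ ∷ ds)         ≡⟨ *-identityˡ _ ⟨
    1 * continuantℕ (d′ ∷ ds)     ≤⟨ *-monoˡ-≤ (continuantℕ (d′ ∷ ds)) (≤-trans (s≤s z≤n) (large zero)) ⟩
    d * continuantℕ (d′ ∷ ds)     ∎)
    where open ≤-Reasoning

  continuant-+ : ∀ (ds : Vec ℕ m) → Large ds → continuant ds ≡ ℤ.+ continuantℕ ds
  continuant-+ [] _ = refl
  continuant-+ (d ∷ []) _ = refl
  continuant-+ (d ∷ d′ ∷ ds) large = begin
    ℤ.+ d ℤ.* continuant (d′ ∷ ds) ℤ.- continuant ds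
      ≡⟨ cong₂ (λ a b → ℤ.+ d ℤ.* a ℤ.- b) (continuant-+ (d′ ∷ ds) (large ∘ suc))
                                            (continuant-+ ds (λ i → large (suc (suc i)))) ⟩
    ℤ.+ d ℤ.* ℤ.+ A ℤ.- ℤ.+ B
      ≡⟨ cong (ℤ._- ℤ.+ B) (ℤ.pos-* d A) ⟨
    ℤ.+ (d * A) ℤ.- ℤ.+ B
      ≡⟨ ℤ.m-n≡m⊖n (d * A) B ⟩
    d * A ℤ.⊖ B
      ≡⟨ ℤ.⊖-≥ (subst (B ≤_) (continuantℕ-step d d′ ds large) (m≤n+m B _)) ⟩
    ℤ.+ (d * A ∸ B) ∎
    where
    open ≡-Reasoning
    A = continuantℕ (d′ ∷ ds)
    B = continuantℕ ds

  -- Division rounded up, x = d A - B with B < A. A larger quotient d′ would force B′ to be at least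
  -- A.
  division-unique : ∀ {x A B B′} d d′ → B < A → B′ < A → x + B ≡ d * A → x + B′ ≡ d′ * A → d ≤ d′ → d ≡ d′ × B ≡ B′
  division-unique {x} {A} {B} {B′} d d′ B<A B′<A eq eq′ d≤d′ with d′ ∸ d | m+[n∸m]≡n d≤d′
  ... | zero | refl = sym (+-identityʳ d) ,
    +-cancelˡ-≡ x B B′ (trans eq (trans (cong (_* A) (sym (+-identityʳ d))) (sym eq′)))
  ... | suc k | refl = contradiction B′<A (≤⇒≯ (begin
      A                   ≤⟨ m≤m+n A (k * A) ⟩
      A + k * A           ≤⟨ m≤n+m (A + k * A) B ⟩
      B + (A + k * A)     ≡⟨ +-cancelˡ-≡ x _ B′ (begin-equality
        x + (B + (A + k * A))   ≡⟨ +-assoc x B _ ⟨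
        x + B + (A + k * A)     ≡⟨ cong (_+ (A + k * A)) eq ⟩
        d * A + suc k * A       ≡⟨ *-distribʳ-+ A d (suc k) ⟨
        (d + suc k) * A         ≡⟨ eq′ ⟨
        x + B′                  ∎) ⟩
      B′                  ∎))
    where open ≤-Reasoning

  -- Euclid's algorithm: d = ⌈ K (d ∷ ds) / K ds ⌉.
  continuantℕ-injective : ∀ d d′ (ds ds′ : Vec ℕ m) → Large (d ∷ ds) → Large (d′ ∷ ds′) →
    continuantℕ (d ∷ ds) ≡ continuantℕ (d′ ∷ ds′) → continuantℕ ds ≡ continuantℕ ds′ →
    d ∷ ds ≡ d′ ∷ ds′
  continuantℕ-injective d d′ [] [] _ _ refl _ = refl
  continuantℕ-injective d d′ (e ∷ es) (e′ ∷ es′) large large′ eq₁ eq₂ = cong₂ _∷_ (proj₁ both)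
    (continuantℕ-injective e e′ es es′ (large ∘ suc) (large′ ∘ suc) eq₂ (proj₂ both))
    where
    A = continuantℕ (e ∷ es)
    x = continuantℕ (d ∷ e ∷ es)
    <A : continuantℕ es < A
    <A = proj₂ (continuantℕ-< e es (large ∘ suc))
    <A′ : continuantℕ es′ < A
    <A′ = subst (continuantℕ es′ <_) (sym eq₂) (proj₂ (continuantℕ-< e′ es′ (large′ ∘ suc)))
    step : x + continuantℕ es ≡ d * A
    step = continuantℕ-step d e es large
    step′ : x + continuantℕ es′ ≡ d′ * A
    step′ = subst₂ (λ y a → y + continuantℕ es′ ≡ d′ * a) (sym eq₁) (sym eq₂) (continuantℕ-step d′ e′ es′ large′)
    both : d ≡ d′ × continuantℕ es ≡ continuantℕ es′
    both with ≤-total d d′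
    ... | inj₁ d≤d′ = division-unique d d′ <A <A′ step step′ d≤d′
    ... | inj₂ d′≤d with division-unique d′ d <A′ <A step′ step d′≤d
    ... | p , q = sym p , sym q

  unique-⊆-length : ∀ {A : Set} {xs ys : List A} → Unique xs → (∀ {x} → x ∈ xs → x ∈ ys) → length xs ≤ length ys
  unique-⊆-length [] _ = z≤n
  unique-⊆-length {xs = x ∷ xs} (x∉ ∷ u) ⊆ys with ∈-∃++ (⊆ys (here refl))
  ... | as , bs , refl = begin
      suc (length xs)               ≤⟨ s≤s (unique-⊆-length u ⊆rest) ⟩
      suc (length (as ++ bs))       ≡⟨ cong suc (length-++ as) ⟩
      suc (length as + length bs)   ≡⟨ +-suc (length as) (length bs) ⟨
      length as + length (x ∷ bs)   ≡⟨ length-++ as ⟨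
      length (as ++ x ∷ bs)         ∎
    where
    open ≤-Reasoning
    ⊆rest : ∀ {y} → y ∈ xs → y ∈ as ++ bs
    ⊆rest y∈ with ∈-++⁻ as (⊆ys (there y∈))
    ... | inj₁ p = ∈-++⁺ˡ p
    ... | inj₂ (here refl) = contradiction refl (All.lookup x∉ y∈)
    ... | inj₂ (there p) = ∈-++⁺ʳ as p

  length-choices-const : ∀ {A : Set} (as : List A) m → length (choices {n = m} (λ _ → as)) ≡ length as ^ m
  length-choices-const as zero = refl
  length-choices-const as (suc m) = trans (length-cartesianProductWith _∷_ as _)
    (cong (length as *_) (length-choices-const as m))

  -- The r entries 3, ..., r + 2 start at the least value that `attained` admits.
  diagonals : ℕ → ∀ m → List (Vec ℕ m)
  diagonals r m = choices (λ _ → applyUpTo (3 +_) r)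

  ∈-diagonals : ∀ {r m} {ds : Vec ℕ m} → ds ∈ diagonals r m → ∀ i → 3 ≤ lookup ds i × lookup ds i ≤ 2 + r
  ∈-diagonals {r} {ds = ds} ds∈ i with lookup ds i | ∈-applyUpTo⁻ (3 +_) (∈-choices⁻ (λ _ → applyUpTo (3 +_) r) ds ds∈ i)
  ... | _ | k , k<r , refl = s≤s (s≤s (s≤s z≤n)) , s≤s (s≤s k<r)

  ∈-diagonals-tail : ∀ {r m d} {ds : Vec ℕ m} → d ∷ ds ∈ diagonals r (suc m) → ds ∈ diagonals r m
  ∈-diagonals-tail {r} {m} {d} {ds} p = ∈-choices⁺ _ ds
    (λ i → ∈-choices⁻ (λ _ → applyUpTo (3 +_) r) (d ∷ ds) p (suc i))

  diagonals-unique : ∀ r m → Unique (diagonals r m)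
  diagonals-unique r m = choices-unique _ λ _ →
    Unique.applyUpTo⁺₁ (3 +_) r λ i<j _ eq → <⇒≢ i<j (+-cancelˡ-≡ 3 _ _ eq)

  length-diagonals : ∀ r m → length (diagonals r m) ≡ r ^ m
  length-diagonals r m = trans (length-choices-const (applyUpTo (3 +_) r) m)
    (cong (_^ m) (length-applyUpTo (3 +_) r))

  values : ℕ → ℕ → List ℕ
  values r m = deduplicate _≟_ (map continuantℕ (diagonals r m))

  -- The second member of a pair belongs to a diagonal that is one shorter, so the two factors refer
  -- to paths of different length.
  values-pairs : ∀ r m → r ^ suc m ≤ length (values r (suc m)) * length (values r m)
  values-pairs r m = begin
    r ^ suc m                                             ≡⟨ length-diagonals r (suc m) ⟨
    length (diagonals r (suc m))                          ≡⟨ length-map pair (diagonals r (suc m)) ⟨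
    length (map pair (diagonals r (suc m)))               ≤⟨ unique-⊆-length unique ⊆product ⟩
    length (cartesianProduct (values r (suc m)) (values r m))
      ≡⟨ length-cartesianProductWith _,_ (values r (suc m)) (values r m) ⟩
    length (values r (suc m)) * length (values r m)       ∎
    where
    open ≤-Reasoning
    pair : Vec ℕ (suc m) → ℕ × ℕ
    pair ds = continuantℕ ds , continuantℕ (Vec.tail ds)
    large : ∀ {ds : Vec ℕ (suc m)} → ds ∈ diagonals r (suc m) → Large ds
    large ds∈ i = ≤-trans (s≤s (s≤s z≤n)) (proj₁ (∈-diagonals {r} ds∈ i))
    unique : Unique (map pair (diagonals r (suc m)))
    unique = unique-map pair injective (diagonals-unique r (suc m))
      where
      injective : ∀ {ds es} → ds ∈ diagonals r (suc m) → es ∈ diagonals r (suc m) → pair ds ≡ pair es → ds ≡ es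
      injective {d ∷ ds} {e ∷ es} ds∈ es∈ eq =
        continuantℕ-injective d e ds es (large ds∈) (large es∈) (cong proj₁ eq) (cong proj₂ eq)
    ⊆product : ∀ {v} → v ∈ map pair (diagonals r (suc m)) → v ∈ cartesianProduct (values r (suc m)) (values r m)
    ⊆product v∈ with ∈-map⁻ pair v∈
    ... | d ∷ ds , ds∈ , refl = ∈-cartesianProduct⁺
      (∈-deduplicate⁺ _≟_ (∈-map⁺ continuantℕ ds∈))
      (∈-deduplicate⁺ _≟_ (∈-map⁺ continuantℕ (∈-diagonals-tail ds∈)))

  -- Bounding the number of divisors

  ^-distribʳ-* : ∀ a b k → (a * b) ^ k ≡ a ^ k * b ^ k
  ^-distribʳ-* a b zero = refl
  ^-distribʳ-* a b (suc k) = trans (cong (a * b *_) (^-distribʳ-* a b k)) (solved a b (a ^ k) (b ^ k))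
    where
    solved : ∀ a b c d → a * b * (c * d) ≡ a * c * (b * d)
    solved = solve-∀

  -- Only an upper bound on the number of divisors is wanted, so the list may contain repetitions
  -- and non-divisors.
  record DivisorCover (x : ℕ) : Set where
    field
      list : List ℕ
      covers : ∀ {d} → d ∣ x → d ∈ list

    size : ℕ
    size = length list

  open DivisorCover using (size)

  ∤⇒coprime : ∀ {p d} → Prime p → ¬ p ∣ d → Coprime d p
  ∤⇒coprime p-prime p∤d (c∣d , c∣p) with prime⇒irreducible p-prime c∣p
  ... | inj₁ c≡1 = c≡1
  ... | inj₂ refl = contradiction c∣d p∤d

  coprime-power : ∀ {p d y} e → Coprime d p → d ∣ p ^ e * y → d ∣ y
  coprime-power {y = y} zero coprime d∣ = subst (_ ∣_) (*-identityˡ y) d∣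
  coprime-power {p} {d} {y} (suc e) coprime d∣ =
    coprime-power e coprime (coprime-divisor coprime (subst (d ∣_) (*-assoc p (p ^ e) y) d∣))

  -- A divisor of p ^ (e + 1) * y prime to p divides y; any other is p times a divisor of p ^ e * y.
  -- Each further factor p thus adds one copy of the cover of y.
  cover-power : ∀ {p y} → Prime p → (c : DivisorCover y) → ∀ e →
    ∃ λ (c′ : DivisorCover (p ^ e * y)) → size c′ ≡ suc e * size c
  cover-power {p} {y} p-prime c zero =
    subst (λ z → ∃ λ (c′ : DivisorCover z) → size c′ ≡ 1 * size c) (sym (*-identityˡ y))
          (c , sym (*-identityˡ (size c)))
  cover-power {p} {y} p-prime c (suc e) with cover-power p-prime c e
  ... | c′ , eq = record { list = DivisorCover.list c ++ map (p *_) (DivisorCover.list c′) ; covers = covers } ,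
    (begin
      length (DivisorCover.list c ++ map (p *_) (DivisorCover.list c′))   ≡⟨ length-++ (DivisorCover.list c) ⟩
      size c + length (map (p *_) (DivisorCover.list c′))                 ≡⟨ cong (size c +_) (length-map (p *_) (DivisorCover.list c′)) ⟩
      size c + size c′                                                    ≡⟨ cong (size c +_) eq ⟩
      size c + suc e * size c                                             ∎)
    where
    open ≡-Reasoning
    covers : ∀ {d} → d ∣ p ^ suc e * y → d ∈ DivisorCover.list c ++ map (p *_) (DivisorCover.list c′)
    covers {d} d∣ with p ∣? d
    ... | no p∤d = ∈-++⁺ˡ (DivisorCover.covers c (coprime-power (suc e) (∤⇒coprime p-prime p∤d) d∣))
    ... | yes (divides k refl) = ∈-++⁺ʳ (DivisorCover.list c)
      (subst (_∈ map (p *_) (DivisorCover.list c′)) (*-comm p k)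
        (∈-map⁺ (p *_) (DivisorCover.covers c′
          (*-cancelˡ-∣ p {{prime⇒nonZero p-prime}} (subst₂ _∣_ (*-comm k p) (*-assoc p (p ^ e) y) d∣)))))

  -- One step of a sieve: all copies of b are split off, so that the remaining primes exceed b. For
  -- composite b nothing is found and e is 0.
  extract : ∀ b (ps : List ℕ) → All Prime ps → All (b ≤_) ps → ∃ λ e → ∃ λ qs →
    product ps ≡ b ^ e * product qs × All Prime qs × All (suc b ≤_) qs × (e ≡ 0 ⊎ Prime b)
  extract b [] [] [] = 0 , [] , refl , [] , [] , inj₁ refl
  extract b (p ∷ ps) (p-prime ∷ primes) (b≤p ∷ b≤) with extract b ps primes b≤ | b ≟ p
  ... | e , qs , eq , primes′ , b< , _ | yes refl =
    suc e , qs , trans (cong (b *_) eq) (sym (*-assoc b (b ^ e) _)) , primes′ , b< , inj₂ p-prime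
  ... | e , qs , eq , primes′ , b< , side | no b≢p =
    e , p ∷ qs , trans (cong (p *_) eq) (solved p (b ^ e) (product qs)) , p-prime ∷ primes′ , ≤∧≢⇒< b≤p b≢p ∷ b< , side
    where
    solved : ∀ p c q → p * (c * q) ≡ c * (p * q)
    solved = solve-∀

  n<2^n : ∀ n → n < 2 ^ n
  n<2^n zero = s≤s z≤n
  n<2^n (suc n) = begin-strict
    suc n              ≤⟨ n<2^n n ⟩
    2 ^ n              <⟨ m<m+n (2 ^ n) (≤-trans (≤-trans (s≤s z≤n) (n<2^n n)) (m≤m+n (2 ^ n) 0)) ⟩
    2 ^ suc n          ∎
    where open ≤-Reasoning

  2≤prime : ∀ {p} → Prime p → 2 ≤ p
  2≤prime p-prime = nonTrivial⇒n>1 _ {{prime⇒nonTrivial p-prime}}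

  -- A factor p ≥ 2 ^ k doubles the number of divisors, hence multiplies its k-th power by at most p.
  cover-large : ∀ k ps → All Prime ps → All (2 ^ k ≤_) ps →
    ∃ λ (c : DivisorCover (product ps)) → size c ^ k ≤ product ps
  cover-large k [] [] [] = record { list = 1 ∷ [] ; covers = λ d∣1 → here (∣1⇒≡1 d∣1) } , ≤-reflexive (^-zeroˡ k)
  cover-large k (p ∷ ps) (p-prime ∷ primes) (2^k≤p ∷ large) with cover-large k ps primes large
  ... | c , bound with cover-power p-prime c 1
  ... | c′ , eq = subst (λ z → ∃ λ (c : DivisorCover (z * product ps)) → size c ^ k ≤ p * product ps) (*-identityʳ p)
    (c′ , (begin
      size c′ ^ k             ≡⟨ cong (_^ k) eq ⟩
      (2 * size c) ^ k        ≡⟨ ^-distribʳ-* 2 (size c) k ⟩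
      2 ^ k * size c ^ k      ≤⟨ *-mono-≤ 2^k≤p bound ⟩
      p * product ps          ∎))
    where open ≤-Reasoning

  module _ (k E : ℕ) where

    -- The sieve value b climbs to 2 ^ k, with j values still to come. A prime b has multiplicity at
    -- most E because the product is at most 2 ^ E, so it costs at most (E + 1) ^ k in the k-th
    -- power. Primes from 2 ^ k on are paid for by the product itself, in `cover-large`.
    cover-from : ∀ j b → b + j ≡ 2 ^ k → ∀ ps → All Prime ps → All (b ≤_) ps → product ps ≤ 2 ^ E →
      ∃ λ (c : DivisorCover (product ps)) → size c ^ k ≤ (suc E ^ k) ^ j * product ps
    cover-from zero b b+0≡ ps primes b≤ _ with cover-large k ps primes
      (subst (λ b → All (b ≤_) ps) (trans (sym (+-identityʳ b)) b+0≡) b≤)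
    ... | c , bound = c , ≤-trans bound (≤-reflexive (sym (*-identityˡ _)))
    cover-from (suc j) b b+j≡ ps primes b≤ ≤2^E with extract b ps primes b≤
    ... | zero , qs , eq , primes′ , b< , _
      with cover-from j (suc b) (trans (sym (+-suc b j)) b+j≡) qs primes′ b<
             (subst (_≤ 2 ^ E) (trans eq (*-identityˡ _)) ≤2^E)
    ... | c , bound = subst (λ x → ∃ λ (c : DivisorCover x) → size c ^ k ≤ (suc E ^ k) ^ suc j * x)
      (sym (trans eq (*-identityˡ _))) (c , ≤-trans bound
        (*-monoˡ-≤ (product qs) (m≤n*m ((suc E ^ k) ^ j) (suc E ^ k) {{m^n≢0 (suc E) k}})))
    cover-from (suc j) b b+j≡ ps primes b≤ ≤2^E | e@(suc _) , qs , eq , primes′ , b< , inj₂ p-prime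
      with cover-from j (suc b) (trans (sym (+-suc b j)) b+j≡) qs primes′ b<
             (≤-trans (m≤n*m (product qs) (b ^ e) {{m^n≢0 b e {{prime⇒nonZero p-prime}}}}) (subst (_≤ 2 ^ E) eq ≤2^E))
    ... | c , bound with cover-power p-prime c e
    ... | c′ , eq′ = subst (λ x → ∃ λ (c : DivisorCover x) → size c ^ k ≤ (suc E ^ k) ^ suc j * x) (sym eq)
      (c′ , (begin
        size c′ ^ k                                              ≡⟨ cong (_^ k) eq′ ⟩
        (suc e * size c) ^ k                                     ≡⟨ ^-distribʳ-* (suc e) (size c) k ⟩
        suc e ^ k * size c ^ k                                   ≤⟨ *-mono-≤ (^-monoˡ-≤ k (s≤s e≤E)) bound ⟩
        suc E ^ k * ((suc E ^ k) ^ j * product qs)               ≡⟨ *-assoc (suc E ^ k) _ _ ⟨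
        (suc E ^ k) ^ suc j * product qs                         ≤⟨ *-monoʳ-≤ ((suc E ^ k) ^ suc j) qs≤ ⟩
        (suc E ^ k) ^ suc j * (b ^ e * product qs)               ∎))
      where
      open ≤-Reasoning
      instance
        b≢0 : NonZero b
        b≢0 = prime⇒nonZero p-prime
        b^e≢0 : NonZero (b ^ e)
        b^e≢0 = m^n≢0 b e
      qs≤ : product qs ≤ b ^ e * product qs
      qs≤ = m≤n*m (product qs) (b ^ e)
      positive : ∀ {qs} → All Prime qs → 0 < product qs
      positive [] = s≤s z≤n
      positive (p-prime ∷ primes) = *-mono-≤ {1} {_} {1} (≤-trans (s≤s z≤n) (2≤prime p-prime)) (positive primes)
      2^e≤2^E : 2 ^ e ≤ 2 ^ E
      2^e≤2^E = begin
        2 ^ e                   ≤⟨ ^-monoˡ-≤ e (2≤prime p-prime) ⟩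
        b ^ e                   ≤⟨ m≤m*n (b ^ e) (product qs) {{>-nonZero (positive primes′)}} ⟩
        b ^ e * product qs      ≡⟨ eq ⟨
        product ps              ≤⟨ ≤2^E ⟩
        2 ^ E                   ∎
      e≤E : e ≤ E
      e≤E = ≮⇒≥ λ E<e → <⇒≱ (^-monoʳ-< 2 (s≤s (s≤s z≤n)) E<e) 2^e≤2^E

    -- The classical bound d(x) = O(x^ε) with ε close to 1/k, as a k-th power. For fixed k the
    -- factor in front of x is polynomial in E.
    divisorCover : ∀ x → 0 < x → x ≤ 2 ^ E →
      ∃ λ (c : DivisorCover x) → size c ^ k ≤ (suc E ^ k) ^ (2 ^ k) * x
    divisorCover x 0<x x≤ = subst (λ x → ∃ λ (c : DivisorCover x) → size c ^ k ≤ (suc E ^ k) ^ (2 ^ k) * x)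
      (sym isFactorisation)
      (cover-from (2 ^ k) 0 refl factors factorsPrime (All.universal (λ _ → z≤n) factors)
        (subst (_≤ 2 ^ E) isFactorisation x≤))
      where open PrimeFactorisation (factorise x {{>-nonZero 0<x}})

  -- Every a lies in the cover of some t, so there are at most |ts| times the largest cover size of
  -- them. Taking the maximum keeps the bound C on a single power.
  covered-length : ∀ k C {as ts : List ℕ} → 0 < C → Unique as →
    All (λ t → ∃ λ (c : DivisorCover t) → size c ^ suc k ≤ C) ts →
    (∀ {a} → a ∈ as → ∃ λ t → t ∈ ts × a ∣ t) →
    length as ^ suc k ≤ length ts ^ suc k * C
  covered-length k C {as} {ts} 0<C unique covers divisor = begin
    length as ^ suc k                   ≤⟨ ^-monoˡ-≤ (suc k) (≤-trans (unique-⊆-length unique ⊆L) L≤) ⟩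
    (length ts * c) ^ suc k             ≡⟨ ^-distribʳ-* (length ts) c (suc k) ⟩
    length ts ^ suc k * c ^ suc k       ≤⟨ *-monoʳ-≤ (length ts ^ suc k) c^k≤C ⟩
    length ts ^ suc k * C               ∎
    where
    open ≤-Reasoning
    gather : ∀ {ts} → All (λ t → ∃ λ (c : DivisorCover t) → size c ^ suc k ≤ C) ts →
      ∃ λ L → ∃ λ c → length L ≤ length ts * c × c ^ suc k ≤ C × (∀ {t a} → t ∈ ts → a ∣ t → a ∈ L)
    -- Without any t the maximum is 0, and its power is 0 because the exponent is a successor.
    gather [] = [] , 0 , z≤n , z≤n , λ ()
    gather {t ∷ ts} ((c , bound) ∷ covers) with gather covers
    ... | L , b , L≤ , b^k≤C , ∈L = DivisorCover.list c ++ L , size c ⊔ b ,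
        (begin
          length (DivisorCover.list c ++ L)                    ≡⟨ length-++ (DivisorCover.list c) ⟩
          size c + length L                                    ≤⟨ +-monoʳ-≤ (size c) L≤ ⟩
          size c + length ts * b                               ≤⟨ +-mono-≤ (m≤m⊔n (size c) b) (*-monoʳ-≤ (length ts) (m≤n⊔m (size c) b)) ⟩
          (size c ⊔ b) + length ts * (size c ⊔ b)              ∎) ,
        maximum (⊔-sel (size c) b) ,
        λ { (here refl) a∣ → ∈-++⁺ˡ (DivisorCover.covers c a∣) ; (there t∈) a∣ → ∈-++⁺ʳ (DivisorCover.list c) (∈L t∈ a∣) }
      where
      maximum : size c ⊔ b ≡ size c ⊎ size c ⊔ b ≡ b → (size c ⊔ b) ^ suc k ≤ C
      maximum (inj₁ eq) = subst (λ z → z ^ suc k ≤ C) (sym eq) bound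
      maximum (inj₂ eq) = subst (λ z → z ^ suc k ≤ C) (sym eq) b^k≤C
    g = gather covers
    L = proj₁ g
    c = proj₁ (proj₂ g)
    L≤ : length L ≤ length ts * c
    L≤ = proj₁ (proj₂ (proj₂ g))
    c^k≤C : c ^ suc k ≤ C
    c^k≤C = proj₁ (proj₂ (proj₂ (proj₂ g)))
    ⊆L : ∀ {a} → a ∈ as → a ∈ L
    ⊆L a∈ with divisor a∈
    ... | t , t∈ , a∣t = proj₂ (proj₂ (proj₂ (proj₂ g))) t∈ a∣t

-- From continuants to tree counts, and the choice of parameters

open import Defs
open DoubledPath
open Counting
open import Data.Nat
open import Data.Nat.Properties
open import Data.Nat.Divisibility using (_∣_; divides)
open import Data.Nat.DivMod using (m/n*n≤m; m≡m%n+[m/n]*n; m%n<n; m≥n⇒m/n>0)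
open import Data.Nat.Tactic.RingSolver using (solve-∀)
import Data.Integer as ℤ
import Data.Integer.Properties as ℤ
open import Data.List using (List; []; _∷_; length; deduplicate)
open import Data.List.Membership.Propositional using (_∈_)
open import Data.List.Membership.Propositional.Properties using (∈-map⁻; ∈-deduplicate⁺; ∈-deduplicate⁻)
open import Data.List.Relation.Unary.Any using (here; there)
open import Data.List.Relation.Unary.All as All using (All; []; _∷_)
import Data.List.Relation.Unary.All.Properties as All
open import Data.List.Relation.Unary.Unique.Propositional using (Unique)
open import Data.List.Relation.Unary.Unique.DecPropositional.Properties _≟_ using (deduplicate-!)
open import Data.Product using (Σ; _×_; _,_; ∃; proj₁; proj₂)
open import Data.Sum using (_⊎_; inj₁; inj₂)
open import Relation.Binary.PropositionalEquality
  using (_≡_; refl; sym; trans; cong; cong₂; module ≡-Reasoning)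

collect : ∀ {Q : ℕ → Set} as → All (λ a → ∃ λ t → Q t × a ∣ t) as →
  ∃ λ ts → All Q ts × (∀ {a} → a ∈ as → ∃ λ t → t ∈ ts × a ∣ t)
collect [] [] = [] , [] , λ ()
collect (a ∷ as) ((t , q , a∣t) ∷ rest) with collect as rest
... | ts , qs , find = t ∷ ts , q ∷ qs ,
  λ { (here refl) → t , here refl , a∣t ; (there a∈) → let t′ , t∈ , d = find a∈ in t′ , there t∈ , d }

-- The bound of `divisorCover` for x ≤ n ^ n, with E = n * n supplied by `n^n≤2^n²`.
loss : ℕ → ℕ → ℕ
loss k n = (suc (n * n) ^ k) ^ (2 ^ k) * n ^ n

loss-positive : ∀ k n → .{{NonZero n}} → 0 < loss k n
loss-positive k n = >-nonZero⁻¹ (loss k n)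
  {{m*n≢0 ((suc (n * n) ^ k) ^ (2 ^ k)) (n ^ n)
    {{m^n≢0 (suc (n * n) ^ k) (2 ^ k) {{m^n≢0 (suc (n * n)) k}}}} {{m^n≢0 n n}}}}

n^n≤2^n² : ∀ n → n ^ n ≤ 2 ^ (n * n)
n^n≤2^n² n = ≤-trans (^-monoˡ-≤ n (<⇒≤ (n<2^n n))) (≤-reflexive (^-*-assoc 2 n n))

Realised : ℕ → ℕ → List ℕ → Set
Realised k n as = ∃ λ ts → Unique ts × All (InT n) ts × length as ^ suc k ≤ length ts ^ suc k * loss (suc k) n

-- The largest diagonal entry r + 2 must not exceed h + 1, hence r < h. Several continuants may
-- divide the same tree count; `covered-length` accounts for that.
realised : ∀ k {r m h n} → suc (m + (m + h)) ≡ n → r < h → Realised k n (values r m)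
realised k {r} {m} {h} {n} refl r<h = deduplicate _≟_ ts , deduplicate-! ts ,
  All.deduplicate⁺ _≟_ (All.map proj₁ good) ,
  covered-length k (loss (suc k) n) {values r m} {deduplicate _≟_ ts} (loss-positive (suc k) n)
    (deduplicate-! _)
    (All.deduplicate⁺ _≟_ (All.map proj₂ good))
    (λ a∈ → let t , t∈ , a∣t = proj₂ (proj₂ collected) a∈ in t , ∈-deduplicate⁺ _≟_ t∈ , a∣t)
  where
  Good : ℕ → Set
  Good t = InT n t × ∃ λ (c : DivisorCover t) → DivisorCover.size c ^ suc k ≤ loss (suc k) n
  source : ∀ {a} → a ∈ values r m → ∃ λ t → Good t × a ∣ t
  source a∈ with ∈-map⁻ continuantℕ (∈-deduplicate⁻ _≟_ _ a∈)
  ... | ds , ds∈ , refl with attained h ds (λ i → proj₁ (∈-diagonals {r} ds∈ i))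
        (λ i → ≤-trans (proj₂ (∈-diagonals {r} ds∈ i)) (s≤s r<h))
  ... | t , inT , 0<t , t≤ , c , eq = t , (inT , cover , ≤-trans bound (*-monoʳ-≤ ((suc (n * n) ^ suc k) ^ (2 ^ suc k)) t≤n^n)) ,
      divides ℤ.∣ c ∣ (begin
        t                                  ≡⟨ cong ℤ.∣_∣ eq ⟩
        ℤ.∣ continuant ds ℤ.* c ∣          ≡⟨ ℤ.abs-* (continuant ds) c ⟩
        ℤ.∣ continuant ds ∣ * ℤ.∣ c ∣      ≡⟨ cong (λ K → ℤ.∣ K ∣ * ℤ.∣ c ∣) (continuant-+ ds large) ⟩
        continuantℕ ds * ℤ.∣ c ∣           ≡⟨ *-comm (continuantℕ ds) ℤ.∣ c ∣ ⟩
        ℤ.∣ c ∣ * continuantℕ ds           ∎)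
    where
    open ≡-Reasoning
    large : Large ds
    large i = ≤-trans (s≤s (s≤s z≤n)) (proj₁ (∈-diagonals {r} ds∈ i))
    t≤n^n : t ≤ n ^ n
    t≤n^n = ≤-trans t≤ (m≤n*m (n ^ (m + (m + h))) n)
    covering = divisorCover (suc k) (n * n) t 0<t (≤-trans t≤n^n (n^n≤2^n² n))
    cover = proj₁ covering
    bound = proj₂ covering
  collected = collect {Good} (values r m) (All.tabulate source)
  ts = proj₁ collected
  good : All Good ts
  good = proj₁ (proj₂ collected)

square-or : ∀ {w} a b → w ≤ a * b → w ≤ a * a ⊎ w ≤ b * b
square-or a b w≤ with ≤-total a b
... | inj₁ a≤b = inj₂ (≤-trans w≤ (*-monoˡ-≤ b a≤b))
... | inj₂ b≤a = inj₁ (≤-trans w≤ (*-monoʳ-≤ a b≤a))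

squared : ∀ k {w n} as → w ≤ length as * length as → Realised k n as →
  ∃ λ ts → Unique ts × All (InT n) ts ×
    w ^ suc k ≤ (length ts ^ suc k * loss (suc k) n) * (length ts ^ suc k * loss (suc k) n)
squared k {w} as w≤ (ts , unique , inT , bound) = ts , unique , inT ,
  ≤-trans (^-monoˡ-≤ (suc k) w≤)
    (≤-trans (≤-reflexive (^-distribʳ-* (length as) (length as) (suc k))) (*-mono-≤ bound bound))

-- Either m + 1 path vertices and r + 1 hub vertices, or m path vertices and r + 3 hub vertices.
manyCounts : ∀ k r m n → m + m + r + 4 ≡ n →
  ∃ λ ts → Unique ts × All (InT n) ts ×
    (r ^ suc m) ^ suc k ≤ (length ts ^ suc k * loss (suc k) n) * (length ts ^ suc k * loss (suc k) n)
manyCounts k r m n eq with square-or (length (values r (suc m))) (length (values r m)) (values-pairs r m)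
... | inj₁ w≤ = squared k (values r (suc m)) w≤
    (realised k {r} {suc m} {suc r} (trans (size m r) eq) ≤-refl)
  where
  size : ∀ m r → suc (suc m + (suc m + suc r)) ≡ m + m + r + 4
  size = solve-∀
... | inj₂ w≤ = squared k (values r m) w≤
    (realised k {r} {m} {3 + r} (trans (size m r) eq) (s≤s (m≤n+m r 2)))
  where
  size : ∀ m r → suc (m + (m + (3 + r))) ≡ m + m + r + 4
  size = solve-∀

^-cancelˡ-≤ : ∀ e .{{_ : NonZero e}} {a b} → a ^ e ≤ b ^ e → a ≤ b
^-cancelˡ-≤ e a^e≤b^e = ≮⇒≥ λ b<a → <⇒≱ (^-monoˡ-< e b<a) a^e≤b^e

-- The polynomial part contributes an exponent that depends on k only, so for large n the term n
-- dominates.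
loss-≤ : ∀ k n → 2 ≤ n → loss k n ≤ n ^ (3 * k * 2 ^ k + n)
loss-≤ k n 2≤n = begin
  (suc (n * n) ^ k) ^ (2 ^ k) * n ^ n      ≤⟨ *-monoˡ-≤ (n ^ n) (^-monoˡ-≤ (2 ^ k) (^-monoˡ-≤ k cube)) ⟩
  ((n ^ 3) ^ k) ^ (2 ^ k) * n ^ n          ≡⟨ cong (λ z → z ^ (2 ^ k) * n ^ n) (^-*-assoc n 3 k) ⟩
  (n ^ (3 * k)) ^ (2 ^ k) * n ^ n          ≡⟨ cong (_* n ^ n) (^-*-assoc n (3 * k) (2 ^ k)) ⟩
  n ^ (3 * k * 2 ^ k) * n ^ n              ≡⟨ ^-distribˡ-+-* n (3 * k * 2 ^ k) n ⟨
  n ^ (3 * k * 2 ^ k + n)                  ∎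
  where
  open ≤-Reasoning
  cube : suc (n * n) ≤ n ^ 3
  cube = begin
    1 + n * n          ≤⟨ +-monoˡ-≤ (n * n) (*-mono-≤ {1} {n} {1} {n} (≤-trans (s≤s z≤n) 2≤n) (≤-trans (s≤s z≤n) 2≤n)) ⟩
    n * n + n * n      ≡⟨ solved (n * n) ⟩
    2 * (n * n)        ≤⟨ *-monoˡ-≤ (n * n) 2≤n ⟩
    n * (n * n)        ≡⟨ cong (λ z → n * (n * z)) (*-identityʳ n) ⟨
    n ^ 3              ∎
    where
    solved : ∀ x → x + x ≡ 2 * x
    solved = solve-∀

-- With k = 16 q, C = 4 q = D + 1 and n = 2 (m + 1) + r + 2, where r is close to n / C.
exponents : ∀ p q D B m r n → 4 * q ≡ suc D → 4 * p < q → m + m + r + 4 ≡ n →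
  4 * q * r ≤ n + 4 * q → 12 * q * (4 * B + 1) ≤ n →
  p * n * (2 * (16 * q) * (4 * q)) + 2 * (3 * (16 * q) * B + n) * q * (4 * q) ≤ D * suc m * (16 * q) * q
exponents p q D B m r n C≡ 4p<q size Cr≤ B≤ = *-cancelˡ-≤ 2 (+-cancelʳ-≤ Z _ _ (begin
  2 * X + Z
    ≤⟨ +-monoʳ-≤ (2 * X) (+-monoˡ-≤ (k * q * n) (*-monoˡ-≤ (k * q) D[r+2]≤)) ⟩
  2 * X + ((n + 3 * (4 * q)) * (k * q) + k * q * n)
    ≡⟨ collectX p q B n ⟩
  16 * q * q * (16 * p * n + 3 * n + 12 * q * (4 * B + 1))
    -- The condition 4 p + 1 ≤ q leaves a slack of 4 n. The divisor count takes n, the two factors 1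
    -- - 1/C take 2 n, and the last n pays for the terms that do not grow with n.
    ≤⟨ *-monoʳ-≤ (16 * q * q) (begin
      16 * p * n + 3 * n + 12 * q * (4 * B + 1)   ≤⟨ +-monoʳ-≤ (16 * p * n + 3 * n) B≤ ⟩
      16 * p * n + 3 * n + n                      ≡⟨ regroup p n ⟩
      suc (4 * p) * (4 * n)                       ≤⟨ *-monoˡ-≤ (4 * n) 4p<q ⟩
      q * (4 * n)                                 ∎) ⟩
  16 * q * q * (q * (4 * n))
    ≡⟨ expandC q n ⟩
  4 * q * (k * q * n)
    ≡⟨ cong (_* (k * q * n)) C≡ ⟩
  suc D * (k * q * n)
    ≡⟨ cong (λ z → suc D * (k * q * z)) size ⟨
  suc D * (k * q * (m + m + r + 4))
    ≡⟨ collectY D q m r ⟩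
  2 * Y + (D * (r + 2) * (k * q) + k * q * (m + m + r + 4))
    ≡⟨ cong (λ z → 2 * Y + (D * (r + 2) * (k * q) + k * q * z)) size ⟩
  2 * Y + Z ∎))
  where
  open ≤-Reasoning
  k = 16 * q
  X = p * n * (2 * (16 * q) * (4 * q)) + 2 * (3 * (16 * q) * B + n) * q * (4 * q)
  Y = D * suc m * (16 * q) * q
  -- Written in terms of n, 2 * Y is 4 * q * (k * q * n) minus Z; adding Z to both sides avoids
  -- truncated subtraction.
  Z = D * (r + 2) * (k * q) + k * q * n
  D[r+2]≤ : D * (r + 2) ≤ n + 3 * (4 * q)
  D[r+2]≤ = begin
    D * (r + 2)                          ≤⟨ *-monoˡ-≤ (r + 2) (n≤1+n D) ⟩
    suc D * (r + 2)                      ≡⟨ cong (_* (r + 2)) C≡ ⟨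
    4 * q * (r + 2)                      ≡⟨ *-distribˡ-+ (4 * q) r 2 ⟩
    4 * q * r + 4 * q * 2                ≤⟨ +-monoˡ-≤ (4 * q * 2) Cr≤ ⟩
    n + 4 * q + 4 * q * 2                ≡⟨ solved n (4 * q) ⟩
    n + 3 * (4 * q)                      ∎
    where
    solved : ∀ n c → n + c + c * 2 ≡ n + 3 * c
    solved = solve-∀
  collectX : ∀ p q B n →
    2 * (p * n * (2 * (16 * q) * (4 * q)) + 2 * (3 * (16 * q) * B + n) * q * (4 * q)) +
      ((n + 3 * (4 * q)) * (16 * q * q) + 16 * q * q * n) ≡
    16 * q * q * (16 * p * n + 3 * n + 12 * q * (4 * B + 1))
  collectX = solve-∀
  regroup : ∀ p n → 16 * p * n + 3 * n + n ≡ suc (4 * p) * (4 * n)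
  regroup = solve-∀
  expandC : ∀ q n → 16 * q * q * (q * (4 * n)) ≡ 4 * q * (16 * q * q * n)
  expandC = solve-∀
  collectY : ∀ D q m r → suc D * (16 * q * q * (m + m + r + 4)) ≡
    2 * (D * suc m * (16 * q) * q) + (D * (r + 2) * (16 * q * q) + 16 * q * q * (m + m + r + 4))
  collectY = solve-∀

-- Eliminates r: both inequalities are raised until r occurs with the same exponent, and the common
-- power of n is then cancelled.
compare-powers : ∀ n r S a b c d e f .{{_ : NonZero n}} → n ^ c ≤ r ^ d → (r ^ a) ≤ S ^ b * n ^ e →
  f + e * d ≤ c * a → n ^ f ≤ S ^ (b * d)
compare-powers n r S a b c d e f n^c≤r^d bound f+ed≤ca =
  *-cancelʳ-≤ (n ^ f) (S ^ (b * d)) (n ^ (e * d)) {{m^n≢0 n (e * d)}} (begin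
    n ^ f * n ^ (e * d)            ≡⟨ ^-distribˡ-+-* n f (e * d) ⟨
    n ^ (f + e * d)                ≤⟨ ^-monoʳ-≤ n f+ed≤ca ⟩
    n ^ (c * a)                    ≡⟨ ^-*-assoc n c a ⟨
    (n ^ c) ^ a                    ≤⟨ ^-monoˡ-≤ a n^c≤r^d ⟩
    (r ^ d) ^ a                    ≡⟨ trans (^-*-assoc r d a) (trans (cong (r ^_) (*-comm d a)) (sym (^-*-assoc r a d))) ⟩
    (r ^ a) ^ d                    ≤⟨ ^-monoˡ-≤ d bound ⟩
    (S ^ b * n ^ e) ^ d            ≡⟨ ^-distribʳ-* (S ^ b) (n ^ e) d ⟩
    (S ^ b) ^ d * (n ^ e) ^ d      ≡⟨ cong₂ _*_ (^-*-assoc S b d) (^-*-assoc n e d) ⟩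
    S ^ (b * d) * n ^ (e * d)      ∎)
  where open ≤-Reasoning

-- r must be small enough to leave almost all vertices to the two paths, and still proportional to n
-- so that r ^ m is close to n ^ m on the logarithmic scale.
record Split (C n : ℕ) : Set where
  field
    m r : ℕ
    size : m + m + r + 4 ≡ n
    small : C * r ≤ n + C
    large : n ≤ 2 * C * r

split : ∀ C n .{{_ : NonZero C}} → 5 ≤ C → C ≤ n → Split C n
split C n 5≤C C≤n = record
  { m = m ; r = u + s ; size = size
  ; small = begin
      C * (u + s)        ≤⟨ *-monoʳ-≤ C (+-monoʳ-≤ u s≤1) ⟩
      C * (u + 1)        ≡⟨ *-distribˡ-+ C u 1 ⟩
      C * u + C * 1      ≡⟨ cong₂ _+_ (*-comm C u) (*-identityʳ C) ⟩
      u * C + C          ≤⟨ +-monoˡ-≤ C (m/n*n≤m n C) ⟩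
      n + C              ∎
  ; large = begin
      n                  ≡⟨ m≡m%n+[m/n]*n n C ⟩
      n % C + u * C      ≤⟨ +-monoˡ-≤ (u * C) (<⇒≤ (m%n<n n C)) ⟩
      (1 + u) * C        ≤⟨ *-monoˡ-≤ C (+-monoˡ-≤ u 1≤u) ⟩
      (u + u) * C        ≡⟨ doubled u C ⟩
      2 * C * u          ≤⟨ *-monoʳ-≤ (2 * C) (m≤m+n u s) ⟩
      2 * C * (u + s)    ∎
  }
  where
  open ≤-Reasoning
  doubled : ∀ u C → (u + u) * C ≡ 2 * C * u
  doubled = solve-∀
  u v m s : ℕ
  -- r is u corrected by the parity s, which makes n - r - 4 even and equal to 2 m.
  u = n / C
  v = n ∸ (u + 4)
  m = v / 2
  s = v % 2
  s≤1 : s ≤ 1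
  s≤1 = s≤s⁻¹ (m%n<n v 2)
  1≤u : 1 ≤ u
  1≤u = m≥n⇒m/n>0 C≤n
  u+4≤n : u + 4 ≤ n
  u+4≤n = begin
    u + 4          ≤⟨ +-monoʳ-≤ u (*-monoʳ-≤ 4 1≤u) ⟩
    5 * u          ≤⟨ *-monoˡ-≤ u 5≤C ⟩
    C * u          ≡⟨ *-comm C u ⟩
    u * C          ≤⟨ m/n*n≤m n C ⟩
    n              ∎
  size : m + m + (u + s) + 4 ≡ n
  size = begin-equality
    m + m + (u + s) + 4        ≡⟨ regroup m u s ⟩
    (s + m * 2) + (u + 4)      ≡⟨ cong (_+ (u + 4)) (m≡m%n+[m/n]*n v 2) ⟨
    v + (u + 4)                ≡⟨ m∸n+n≡m u+4≤n ⟩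
    n                          ∎
    where
    regroup : ∀ m u s → m + m + (u + s) + 4 ≡ (s + m * 2) + (u + 4)
    regroup = solve-∀

-- The constant 2 C lost in r, raised to the power C, is at most n, so it costs just one of the C
-- factors n.
nearly-root : ∀ C D n r .{{_ : NonZero n}} → C ≡ suc D → n ≤ 2 * C * r → (2 * C) ^ C ≤ n → n ^ D ≤ r ^ C
nearly-root C D n r refl n≤ power≤n = *-cancelˡ-≤ n (begin
  n ^ C                  ≤⟨ ^-monoˡ-≤ C n≤ ⟩
  (2 * C * r) ^ C        ≡⟨ ^-distribʳ-* (2 * C) r C ⟩
  (2 * C) ^ C * r ^ C    ≤⟨ *-monoˡ-≤ (r ^ C) power≤n ⟩
  n * r ^ C              ∎)
  where open ≤-Reasoning

-- Since exp((p/q) n log n) = n^(p n/q), raising to the power q removes the real numbers, and a list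
-- of distinct elements bounds the size of the set from below. Every real c with 0 < c < 1/4 lies
-- below such a fraction p/q, so the real form follows.
theorem1p1 : (p q : ℕ) → 0 < p → 4 * p < q →
    Σ ℕ λ n₀ → (n : ℕ) → n₀ ≤ n →
    Σ (List ℕ) λ ms → Unique ms × All (InT n) ms × (n ^ (p * n) ≤ length ms ^ q)
-- The first summand of the threshold serves `nearly-root`, the second makes the terms independent
-- of n in `exponents` at most n.
theorem1p1 p q@(suc (suc q′)) _ 4p<q = (2 * C) ^ C + 12 * q * (4 * 2 ^ k + 1) , bound
  where
  C k D : ℕ
  -- About a fraction 1/C of the vertices are hubs, and 1/k is the exponent of the divisor bound.
  -- Both must be small against 1/4 - p/q, which is at least 1/(4 q).
  C = 4 * q
  k = 16 * q
  D = pred C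
  C≤power : C ≤ (2 * C) ^ C
  C≤power = begin
    C                ≤⟨ m≤n*m C 2 ⟩
    2 * C            ≡⟨ *-identityʳ (2 * C) ⟨
    (2 * C) ^ 1      ≤⟨ ^-monoʳ-≤ (2 * C) {1} {C} (s≤s z≤n) ⟩
    (2 * C) ^ C      ∎
    where open ≤-Reasoning
  5≤C : 5 ≤ C
  5≤C = ≤-trans (s≤s (s≤s (s≤s (s≤s (s≤s z≤n))))) (*-monoʳ-≤ 4 {2} {q} (s≤s (s≤s z≤n)))
  bound : (n : ℕ) → (2 * C) ^ C + 12 * q * (4 * 2 ^ k + 1) ≤ n →
    Σ (List ℕ) λ ms → Unique ms × All (InT n) ms × (n ^ (p * n) ≤ length ms ^ q)
  -- The exponent 2 k C clears three roots: the square root from the pairs, the k-th root of the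
  -- divisor bound and the C-th root in `nearly-root`.
  bound n n₀≤n = ts , unique , inT , ^-cancelˡ-≤ (2 * k * C) (begin
      (n ^ (p * n)) ^ (2 * k * C)       ≡⟨ ^-*-assoc n (p * n) (2 * k * C) ⟩
      n ^ (p * n * (2 * k * C))         ≤⟨ compare-powers n r S (suc m * k * q) (2 * k * q) D C (W * q) _
                                             (nearly-root C D n r refl large power≤n) powers exponent ⟩
      S ^ (2 * k * q * C)               ≡⟨ cong (S ^_) (regroup k q C) ⟩
      S ^ (q * (2 * k * C))             ≡⟨ ^-*-assoc S q (2 * k * C) ⟨
      (S ^ q) ^ (2 * k * C)             ∎)
    where
    open ≤-Reasoning
    power≤n : (2 * C) ^ C ≤ n
    power≤n = ≤-trans (m≤m+n ((2 * C) ^ C) (12 * q * (4 * 2 ^ k + 1))) n₀≤n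
    C≤n : C ≤ n
    C≤n = ≤-trans C≤power power≤n
    2≤n : 2 ≤ n
    2≤n = ≤-trans (≤-trans (s≤s (s≤s z≤n)) 5≤C) C≤n
    instance
      n≢0 : NonZero n
      n≢0 = >-nonZero (≤-trans (s≤s z≤n) 2≤n)
    open Split (split C n 5≤C C≤n)
    counts = manyCounts (pred k) r m n size
    ts = proj₁ counts
    unique = proj₁ (proj₂ counts)
    inT = proj₁ (proj₂ (proj₂ counts))
    S = length ts
    W = 2 * (3 * k * 2 ^ k + n)
    regroup : ∀ k q C → 2 * k * q * C ≡ q * (2 * k * C)
    regroup = solve-∀
    exponent : p * n * (2 * k * C) + W * q * C ≤ D * (suc m * k * q)
    exponent = ≤-trans
      (exponents p q D (2 ^ k) m r n refl 4p<q size small (≤-trans (m≤n+m (12 * q * (4 * 2 ^ k + 1)) ((2 * C) ^ C)) n₀≤n))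
      (≤-reflexive (reassociate D m k q))
      where
      reassociate : ∀ D m k q → D * suc m * k * q ≡ D * (suc m * k * q)
      reassociate = solve-∀
    powers : r ^ (suc m * k * q) ≤ S ^ (2 * k * q) * n ^ (W * q)
    powers = begin
      r ^ (suc m * k * q)
        ≡⟨ trans (cong (_^ q) (^-*-assoc r (suc m) k)) (^-*-assoc r (suc m * k) q) ⟨
      ((r ^ suc m) ^ k) ^ q
        ≤⟨ ^-monoˡ-≤ q (proj₂ (proj₂ (proj₂ counts))) ⟩
      ((S ^ k * loss k n) * (S ^ k * loss k n)) ^ q
        ≤⟨ ^-monoˡ-≤ q (*-mono-≤ (*-monoʳ-≤ (S ^ k) (loss-≤ k n 2≤n)) (*-monoʳ-≤ (S ^ k) (loss-≤ k n 2≤n))) ⟩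
      ((S ^ k * n ^ (3 * k * 2 ^ k + n)) * (S ^ k * n ^ (3 * k * 2 ^ k + n))) ^ q
        ≡⟨ cong (_^ q) (trans (interchange (S ^ k) (n ^ (3 * k * 2 ^ k + n)))
             (cong₂ _*_ (power-2 S k) (power-2 n (3 * k * 2 ^ k + n)))) ⟩
      (S ^ (2 * k) * n ^ W) ^ q
        ≡⟨ ^-distribʳ-* (S ^ (2 * k)) (n ^ W) q ⟩
      (S ^ (2 * k)) ^ q * (n ^ W) ^ q
        ≡⟨ cong₂ _*_ (^-*-assoc S (2 * k) q) (^-*-assoc n W q) ⟩
      S ^ (2 * k * q) * n ^ (W * q) ∎
      where
      interchange : ∀ a b → a * b * (a * b) ≡ a * a * (b * b)
      interchange = solve-∀
      power-2 : ∀ x e → x ^ e * x ^ e ≡ x ^ (2 * e)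
      power-2 x e = trans (sym (^-distribˡ-+-* x e e)) (cong (λ z → x ^ (e + z)) (sym (+-identityʳ e)))
theorem1p1 (suc p) (suc zero) _ (s≤s ())
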